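{- Let $\sigma$ be a switch table for a subgroup $G$ of $\mathrm{Sym}(n)$ of order $k$ with maximal effective row $r$ and $c_i$ non-trivial switches in row $i$, $i=1,2,\dots,r$. Assume that there is a $\mu\in(0,1)$ such that - $m\le\mu(n-r+1)$, - $c_i+1\le\mu(n-i+1-m+1)$ for all $i=1,2,\dots,r$. Then the relative effort $\mathrm{eff}_{\mathrm{mst}}(m)$ of $\sigma$ is at least $\frac32(1-\mu)^{r(m+1)}$, i.e., $$E_{\mathrm{mst}}(m)\ge\frac32(1-\mu)^{r(m+1)}\,km .$$
   Context: Throughout $1\le m<n$, $[n]=\{1,\dots,n\}$. Switch tables. For a subgroup $G\le\mathrm{Sym}(n)$ of order $k$, a switch table is a map $(i,j)\mapsto\sigma_{i,j}\in G$ on $[n]\times[n]$ such that for $j>i$, if some $g\in G$ has $g(j)=i$ and $g(t)=t$ for all $t<i$, then $\sigma_{i,j}$ is one such $g$; otherwise $\sigma_{i,j}=\mathrm{id}$. Non-identity entries are non-trivial; a row is effective if it has a non-trivial entry; $r$ is the largest index of an effective row; $J(i)$ is the set of columns of non-trivial entries in row $i$ and $c_i=|J(i)|$. One has $k=\prod_{j=1}^r(c_j+1)$. Modified switch-table method and cost. A call at level $i$ takes subsets $S,S'\subseteq\{i,\dots,n\}$ with $|S|=|S'|=\ell$; it is started at level $1$ with $\ell=m$. If $\ell=0$, or $i\le r$ and $\ell=n-i+1$, it returns at no cost. If $i=r+1$ and $\ell\ge1$, $S$ and $S'$ are compared lexicographically, counted as $\ell$ single-element evaluations. Otherwise: (element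 branch, $i\in S$) if $i\in S'$, make a call at level $i+1$ with $S\setminus\{i\},S'\setminus\{i\}$; and for each $j\in J(i)\cap S'$ compute $\sigma_{i,j}(S'\setminus\{j\})$ ($\ell-1$ evaluations) and make a call at level $i+1$ with $S\setminus\{i\}$ and this image; (non-element branch, $i\notin S$) if $i\in S'$ or $J(i)\cap S'\ne\emptyset$, return at no cost; otherwise make a call at level $i+1$ with $S,S'$, and for each $j\in J(i)$ compute $\sigma_{i,j}(S')$ ($\ell$ evaluations) and make a call at level $i+1$ with $S$ and this image. A negative answer of a recursive call does not stop the algorithm; all branches are carried out. Typical number $E_{\mathrm{mst}}(m)$: the expected total number of evaluations in the paper's simplified ("hyper-amortized") uniform model, in which in every call at level $i$ with cardinality $\ell$ the two subsets are regarded as independent and uniformly random $\ell$-subsets of $\{i,\dots,n\}$, disregarding their dependence on the subsets of earlier calls. Relative effort: $\mathrm{eff}_{\mathrm{mst}}(m):=E_{\mathrm{mst}}(m)/(km)$, where $km$ is the number of single-element evaluations of the naive method (apply each of the $k$ permutations to all $m$ elements). -}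

module Defs where

open import Algebra.Apartness.Bundles using (HeytingField)
import Algebra.Apartness.Properties.HeytingCommutativeRing as HeytingProperties
open import Algebra.Bundles using (CommutativeRing)
import Algebra.Properties.Ring as RingProperties
import Algebra.Properties.Semiring.Exp as Exp
import Algebra.Properties.Semiring.Mult as Mult
open import Data.Bool.Base using (if_then_else_; not; _∨_)
open import Data.Fin.Base as Fin using (Fin; toℕ)
import Data.Fin.Properties as Fin
open import Data.Fin.Permutation
  using (Permutation′; _⟨$⟩ʳ_; _⟨$⟩ˡ_; _≈_; _∘ₚ_; flip; id)
open import Data.Fin.Subset
  using (Subset; inside; outside; _∩_; _-_; ∣_∣; Nonempty)
open import Data.Fin.Subset.Properties using (_∈?_; nonempty?; Lift?)
open import Data.Integer.Base using (ℤ; +_; -[1+_])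
open import Data.List.Base as List
  using (List; []; _∷_; _++_; foldr; length; take; allFin; cartesianProduct)
open import Data.Nat.Base as ℕ using (ℕ; zero; suc; NonZero)
import Data.Nat.Properties as ℕ
open import Data.Product.Base using (∃; _×_; _,_; proj₁)
open import Data.Rational.Base as ℚ using (ℚ; 0ℚ; ↥_; _/_)
open import Data.Sum.Base using (_⊎_; inj₁; inj₂)
open import Data.Vec.Base as Vec using ([]; _∷_)
open import Function.Base using (_∘_)
open import Function.Bundles using (Inverse)
open import Level using (_⊔_) renaming (zero to 0ℓ; suc to lsuc)
import Relation.Binary.Construct.On as On
open import Relation.Binary.Bundles using (Setoid)
open import Relation.Binary.Core using (Rel)
open import Relation.Binary.Structures using (IsStrictPartialOrder)
open import Relation.Binary.PropositionalEquality using (_≡_; setoid; _→-setoid_)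
open import Relation.Nullary using (¬_; Dec; does)
open import Relation.Nullary.Decidable using (_×-dec_)

private
  variable
    n : ℕ

------------------------------------------------------------------------
-- Ordered fields

-- The order axioms are phrased so that the real numbers satisfy them
-- constructively as well as classically: apartness is `<` or `>`, and
-- `x ≤ y` is the negation of `y < x`.

record OrderedField c ℓ₁ ℓ₂ : Set (lsuc (c ⊔ ℓ₁ ⊔ ℓ₂)) where
  infix 4 _<_ _≤_

  field
    heytingField : HeytingField c ℓ₁ ℓ₂

  open HeytingField heytingField public
    renaming (Carrier to 𝕂; _≈_ to _≈ₖ_)

  field
    _<_                  : Rel 𝕂 ℓ₂
    isStrictPartialOrder : IsStrictPartialOrder _≈ₖ_ _<_
    #⇒<∨>                : ∀ {x y} → x # y → x < y ⊎ y < x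
    <⇒#                  : ∀ {x y} → x < y → x # y
    +-monoˡ-<            : ∀ z {x y} → x < y → x + z < y + z
    *-pos                : ∀ {x y} → 0# < x → 0# < y → 0# < x * y

  _≤_ : Rel 𝕂 ℓ₂
  x ≤ y = ¬ (y < x)

  commutativeRing : CommutativeRing c ℓ₁
  commutativeRing = record { isCommutativeRing = isCommutativeRing }

  open CommutativeRing commutativeRing public using (ring; semiring)
  open Exp semiring public using (_^_)
  open Mult semiring public using () renaming (_×_ to _×ₖ_)

  fromℕ : ℕ → 𝕂
  fromℕ k = k ×ₖ 1#

  fromℤ : ℤ → 𝕂
  fromℤ (+ k)     = fromℕ k
  fromℤ -[1+ k ]  = - fromℕ (suc k)

  private
    module SPO = IsStrictPartialOrder isStrictPartialOrder
    open HeytingProperties heytingCommutativeRing using (1#0)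
    open RingProperties ring using (-‿distribˡ-*; -‿involutive)

  0<1 : 0# < 1#
  0<1 with #⇒<∨> 1#0
  ... | inj₂ 0<1 = 0<1
  ... | inj₁ 1<0 = SPO.<-respʳ-≈ -1*-1≈1 (*-pos 0<-1 0<-1)
    where
    0<-1 : 0# < - 1#
    0<-1 = SPO.<-respˡ-≈ (-‿inverseʳ 1#)
             (SPO.<-respʳ-≈ (+-identityˡ (- 1#)) (+-monoˡ-< (- 1#) 1<0))

    -1*-1≈1 : - 1# * - 1# ≈ₖ 1#
    -1*-1≈1 = trans (sym (-‿distribˡ-* 1# (- 1#)))
                (trans (-‿cong (*-identityˡ (- 1#))) (-‿involutive 1#))

  0<fromℕ : ∀ k → 0# < fromℕ (suc k)
  0<fromℕ zero    = SPO.<-respʳ-≈ (sym (+-identityʳ 1#)) 0<1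
  0<fromℕ (suc k) = SPO.trans (0<fromℕ k)
    (SPO.<-respˡ-≈ (+-identityˡ _) (+-monoˡ-< (fromℕ (suc k)) 0<1))

  recip : ∀ {x} → 0# < x → 𝕂
  recip 0<x = proj₁ (#⇒invertible (#-sym (<⇒# 0<x)))

  fromℚ : ℚ → 𝕂
  fromℚ q = fromℤ (↥ q) * recip (0<fromℕ (ℚ.denominator-1 q))

------------------------------------------------------------------------
-- Finite sets

allSubsets : ∀ n → List (Subset n)
allSubsets zero    = [] ∷ []
allSubsets (suc n) =
  List.map (inside ∷_) (allSubsets n) ++ List.map (outside ∷_) (allSubsets n)

elements : Subset n → List (Fin n)
elements {n} S = List.filter (_∈? S) (allFin n)

image : Permutation′ n → Subset n → Subset n
image π S = Vec.tabulate (λ x → Vec.lookup S (π ⟨$⟩ˡ x))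

------------------------------------------------------------------------
-- Subgroups of the symmetric group

-- The group of all permutations of `Fin n` is taken up to pointwise
-- equality, so the order counts members up to that equality.

record Subgroup n p : Set (lsuc p) where
  infix 4 _∈G

  field
    _∈G      : Permutation′ n → Set p
    ∈-resp-≈ : ∀ {g h} → g ≈ h → g ∈G → h ∈G
    id∈      : id ∈G
    ∘∈       : ∀ {g h} → g ∈G → h ∈G → (g ∘ₚ h) ∈G
    flip∈    : ∀ {g} → g ∈G → flip g ∈G

  members : Setoid p 0ℓ
  members = On.setoid {B = ∃ _∈G} (Fin n →-setoid Fin n) (λ (g , _) → g ⟨$⟩ʳ_)

  field
    order       : ℕ
    enumeration : Inverse (setoid (Fin order)) members

  order-nonZero : NonZero order
  order-nonZero = Fin.nonZeroIndex (Inverse.from enumeration (id , id∈))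

------------------------------------------------------------------------
-- Switch tables

-- The point (or row, column, level) written i ∈ [n] on paper is the
-- element of `Fin n` whose `toℕ` is i - 1.

index : Fin n → ℕ
index i = suc (toℕ i)

Table : ℕ → Set
Table n = Fin n → Fin n → Permutation′ n

module _ {p} (G : Subgroup n p) where
  open Subgroup G

  IsSwitch : Fin n → Fin n → Permutation′ n → Set p
  IsSwitch i j g = g ∈G × g ⟨$⟩ʳ j ≡ i × (∀ t → t Fin.< i → g ⟨$⟩ʳ t ≡ t)

  record IsSwitchTable (σ : Table n) : Set p where
    field
      member  : ∀ i j → σ i j ∈G
      switch  : ∀ i j → i Fin.< j → ∃ (IsSwitch i j) → IsSwitch i j (σ i j)
      trivial : ∀ i j → ¬ (i Fin.< j × ∃ (IsSwitch i j)) → σ i j ≈ id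

module _ (σ : Table n) where

  trivial? : ∀ i j → Dec (σ i j ≈ id)
  trivial? i j = Fin.all? (λ x → (σ i j ⟨$⟩ʳ x) Fin.≟ x)

  J : Fin n → Subset n
  J i = Vec.tabulate (λ j → not (does (trivial? i j)))

  c : Fin n → ℕ
  c i = ∣ J i ∣

  Effective : Fin n → Set
  Effective i = Nonempty (J i)

  IsMaxEffectiveRow : Fin n → Set
  IsMaxEffectiveRow r = Effective r × (∀ i → Effective i → i Fin.≤ r)

------------------------------------------------------------------------
-- The modified switch-table method

record Step n : Set where
  constructor step
  field
    evaluations : ℕ
    calls       : List (Subset n × Subset n)

open Step public

stop : Step n
stop = step 0 []

module _ (σ : Table n) where

  elementBranch : Fin n → Subset n → Subset n → Step n
  elementBranch i S S′ = step
    (length js ℕ.* (∣ S ∣ ℕ.∸ 1))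
    ((if does (i ∈? S′) then (S - i , S′ - i) ∷ [] else []) ++
     List.map (λ j → (S - i , image (σ i j) (S′ - j))) js)
    where
    js : List (Fin n)
    js = elements (J σ i ∩ S′)

  nonElementBranch : Fin n → Subset n → Subset n → Step n
  nonElementBranch i S S′ =
    if does (i ∈? S′) ∨ does (nonempty? (J σ i ∩ S′))
    then stop
    else step
      (length js ℕ.* ∣ S ∣)
      ((S , S′) ∷ List.map (λ j → (S , image (σ i j) S′)) js)
    where
    js : List (Fin n)
    js = elements (J σ i)

  -- A call at a level i ≤ r.  There are `n ∸ toℕ i` points at or above i,
  -- so the second test asks whether S consists of all of them.
  call : Fin n → Subset n → Subset n → Step n
  call i S S′ =
    if does (∣ S ∣ ℕ.≟ 0) ∨ does (∣ S ∣ ℕ.≟ n ℕ.∸ toℕ i) then stop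
    else if does (i ∈? S) then elementBranch i S S′
    else nonElementBranch i S S′

------------------------------------------------------------------------
-- Expected cost in the hyper-amortized uniform model

fromℕℚ : ℕ → ℚ
fromℕℚ k = + k / 1

sumℚ : List ℚ → ℚ
sumℚ = foldr ℚ._+_ 0ℚ

-- The value on the empty list is irrelevant: `mean` is only reached with
-- a nonempty sample space when m < n.
mean : List ℚ → ℚ
mean []       = 0ℚ
mean (x ∷ xs) = sumℚ (x ∷ xs) ℚ.* (+ 1 / suc (length xs))

subsetsFrom : Fin n → ℕ → List (Subset n)
subsetsFrom {n} i ℓ =
  List.filter (λ S → Lift? (i Fin.≤?_) S ×-dec (∣ S ∣ ℕ.≟ ℓ)) (allSubsets n)

module _ (σ : Table n) where

  -- Given the expected total cost `next ℓ` of a call at the next level with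
  -- cardinality ℓ, the expected total cost of a call at level i.  Each
  -- recursive call enters only through its cardinality, since in the model
  -- its subsets are resampled.
  expectedAt : Fin n → (ℕ → ℚ) → (ℕ → ℚ)
  expectedAt i next ℓ = mean (List.map cost (cartesianProduct Ss Ss))
    where
    Ss : List (Subset n)
    Ss = subsetsFrom i ℓ

    cost : Subset n × Subset n → ℚ
    cost (S , S′) =
      fromℕℚ (evaluations s) ℚ.+ sumℚ (List.map (next ∘ ∣_∣ ∘ proj₁) (calls s))
      where
      s : Step n
      s = call σ i S S′

  -- Levels 1, …, r in turn; at level r + 1 the lexicographic comparison of
  -- two ℓ-subsets counts ℓ evaluations (none if ℓ = 0).
  E-mst : Fin n → ℕ → ℚ
  E-mst r = foldr expectedAt fromℕℚ (take (index r) (allFin n))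

  eff-mst : ∀ {p} → Subgroup n p → Fin n → (m : ℕ) → .{{NonZero m}} → ℚ
  eff-mst G r m = E-mst r m ℚ.* (+ 1 / (Subgroup.order G ℕ.* m))
    where
    instance
      km-nonZero : NonZero (Subgroup.order G ℕ.* m)
      km-nonZero = ℕ.m*n≢0 (Subgroup.order G) m {{Subgroup.order-nonZero G}}

{-# OPTIONS --safe #-}

-- Only calls with i ∉ S and S′ disjoint from {i} ∪ J(i) are kept.  Such a pair costs c m
-- evaluations and c + 1 calls with the same cardinality m at the next level.  With N points at or
-- above i, a random pair is of this kind with probability
-- C(N - 1, m) / C(N, m) · C(N - 1 - c, m) / C(N, m) ≥ (1 - μ) · (1 - μ)ᵐ, the first factor by
-- m ≤ μ N and the second, a product of m ratios, by c + 1 ≤ μ (N - m + 1).  So passing from level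
-- i + 1 to level i multiplies the expected cost by at least (1 - μ)ᵐ⁺¹ (c + 1), and at level r,
-- where c ≥ 1, the cost (2c + 1) m ≥ 3/2 (c + 1) m is attained with the same probability.  Finally
-- k ≤ ∏ (cᵢ + 1), since each element of G is a product of switches or identities, one for each
-- row up to r.

module Submission where

open import Defs
open import Algebra.Bundles using (CommutativeRing)
import Algebra.Apartness.Properties.HeytingCommutativeRing as HeytingProperties
import Algebra.Properties.Monoid.Mult as MonoidMult
import Algebra.Properties.Semiring.Exp as SemiringExp
import Algebra.Properties.Semiring.Mult as SemiringMult
import Algebra.Solver.Ring.NaturalCoefficients.Default as SemiringSolver
open import Data.Bool.Base using (true; false; not; if_then_else_; _∨_)
open import Data.Fin.Base as Fin using (Fin; toℕ; fromℕ<)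
open import Data.Fin.Permutation as Perm
  using (Permutation′; _⟨$⟩ʳ_; _⟨$⟩ˡ_; _≈_; _∘ₚ_; flip; inverseˡ; inverseʳ)
import Data.Fin.Properties as Fin
open import Data.Fin.Subset
  using (Subset; inside; outside; ∣_∣; _∈_; _∉_; _⊆_; _∩_; _─_; Nonempty; Lift)
open import Data.Fin.Subset.Properties as Subset
  using (_∈?_; _⊆?_; nonempty?; Lift?; drop-∷-⊆; out⊆; in⊆in)
open import Data.Integer.Base as ℤ using (+_; -[1+_])
import Data.Integer.Properties as ℤ
open import Data.List.Base as List
  using ( List; []; _∷_; _++_; _∷ʳ_; [_]; length; map; filter; foldr; take; allFin; tabulate
        ; cartesianProduct; cartesianProductWith)
open import Data.List.Membership.Propositional using () renaming (_∈_ to _∈ₗ_)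
open import Data.List.Membership.Propositional.Properties
  using (∈-map⁺; ∈-filter⁺; ∈-filter⁻; ∈-allFin; ∈-cartesianProductWith⁺)
import Data.List.Properties as List
open import Data.List.Relation.Unary.All as All using (All; []; _∷_)
open import Data.List.Relation.Unary.Any as Any using (here; there)
open import Data.List.Relation.Unary.Any.Properties using (lookup-index)
open import Data.Nat.Base as ℕ using (ℕ; zero; suc; NonZero; s≤s; z≤n)
open import Data.Nat.Combinatorics using (_C_; nCk+nC[k+1]≡[n+1]C[k+1]; k>n⇒nCk≡0; nC1≡n)
open import Data.Nat.ListAction using (product)
open import Data.Nat.ListAction.Properties using (product-++)
import Data.Nat.Properties as ℕ
open import Data.Nat.Tactic.RingSolver using (solve-∀)
open import Data.Product.Base using (∃; _×_; _,_; proj₁; proj₂)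
open import Data.Rational.Base as ℚ using (ℚ; 0ℚ; 1ℚ; _/_; mkℚ; toℚᵘ; *≤*)
import Data.Rational.Properties as ℚ
open import Data.Rational.Unnormalised.Base as ℚᵘ using (mkℚᵘ; *≡*; *≤*)
import Data.Rational.Unnormalised.Properties as ℚᵘ
open import Data.Sum.Base using (_⊎_; inj₁; inj₂)
open import Data.Vec.Base as Vec using ([]; _∷_; here; there)
import Data.Vec.Properties as Vec
open import Function.Base using (_∘_; id)
open import Function.Bundles using (Inverse)
open import Relation.Binary.Bundles using (Preorder)
open import Relation.Binary.Definitions using (tri<; tri≈; tri>)
open import Relation.Binary.PropositionalEquality as ≡ using (_≡_; _≢_)
import Relation.Binary.Reasoning.Preorder as PreorderReasoning
import Relation.Binary.Reasoning.Setoid as SetoidReasoning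
open import Relation.Binary.Structures using (IsStrictPartialOrder)
open import Relation.Nullary using (¬_; yes; no; does; contradiction)
open import Relation.Nullary.Decidable using (dec-true; dec-false; _×-dec_; ¬?)
open import Relation.Unary using (Pred; Decidable; _≐_)

-- The kept pairs form a product set, one condition on S and one on S′, so their number is a product
-- of two binomial coefficients, and the recursion never leaves cardinality m. N is smallest at row
-- r, so the bound on m there serves every earlier row; with μ < 1 it forces m < N, so the early
-- return for a full set does not occur. In the condition on c, the number N - m + 1 is the smallest
-- denominator among the m ratios (N - 1 - c - j) / (N - j), j < m. The order k stands only on the
-- smaller side of the final inequality, hence the one-sided comparison with the product of the cᵢ +
-- 1. The expected cost is rational, while μ lives in an arbitrary ordered field whose `≤` is a
-- negated `<`. Probabilities are therefore never formed: inequalities are multiplied by the numbers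
-- of samples, the cost estimate is proved in ℚ and carried to the field by clearing denominators,
-- and the positive count is cancelled there.

private
  variable
    n : ℕ

-- Permutation groups

length-elements : (S : Subset n) → length (elements S) ≡ ∣ S ∣
length-elements {zero} [] = ≡.refl
length-elements {suc n} (s ∷ S) = helper s
  where
  -- Stated for an arbitrary `f`, because each tail of `allFin` tabulates a further shifted
  -- function.
  filter-tail : ∀ s {m} (f : Fin m → Fin n) →
    length (filter (_∈? (s ∷ S)) (List.tabulate (Fin.suc ∘ f))) ≡
    length (filter (_∈? S) (List.tabulate f))
  filter-tail s {zero}  f = ≡.refl
  filter-tail s {suc m} f with does (f Fin.zero ∈? S)
  ... | inside  = ≡.cong suc (filter-tail s (f ∘ Fin.suc))
  ... | outside = filter-tail s (f ∘ Fin.suc)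

  helper : ∀ s → length (elements (s ∷ S)) ≡ ∣ s ∷ S ∣
  helper inside  = ≡.cong suc (≡.trans (filter-tail inside id) (length-elements S))
  helper outside = ≡.trans (filter-tail outside id) (length-elements S)

length-cartesianProductWith : ∀ {a b c} {A : Set a} {B : Set b} {C : Set c} (f : A → B → C) xs ys →
  length (cartesianProductWith f xs ys) ≡ length xs ℕ.* length ys
length-cartesianProductWith f []       ys = ≡.refl
length-cartesianProductWith f (x ∷ xs) ys =
  ≡.trans (List.length-++ (map (f x) ys))
    (≡.cong₂ ℕ._+_ (List.length-map (f x) ys) (length-cartesianProductWith f xs ys))

∈J : (σ : Table n) {i j : Fin n} → σ i j ⟨$⟩ʳ j ≡ i → i ≢ j → j ∈ J σ i
∈J σ {i} {j} σj≡i i≢j = Vec.lookup⇒[]= j _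
  (≡.trans (Vec.lookup∘tabulate _ j)
    (≡.cong not (dec-false (trivial? σ i j) λ σ≈id → i≢j (≡.trans (≡.sym σj≡i) (σ≈id j)))))

module _ {p} (G : Subgroup n p) {σ : Table n} (isSwitchTable : IsSwitchTable G σ) where
  open Subgroup G
  open IsSwitchTable isSwitchTable

  FixesBelow : ℕ → Permutation′ n → Set
  FixesBelow s g = ∀ t → toℕ t ℕ.< s → g ⟨$⟩ʳ t ≡ t

  -- Representatives for one step of the stabiliser chain. The identity stands for the elements that
  -- already fix i, which accounts for the 1 in c + 1.
  switches : Fin n → List (Permutation′ n)
  switches i = Perm.id ∷ map (σ i) (elements (J σ i))

  length-switches : ∀ i → length (switches i) ≡ suc (c σ i)
  length-switches i = ≡.cong suc
    (≡.trans (List.length-map (σ i) (elements (J σ i))) (length-elements (J σ i)))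

  preimage-switch : ∀ {i} g → g ∈G → FixesBelow (toℕ i) g → let j = g ⟨$⟩ˡ i in
    j ≡ i ⊎ (IsSwitch G i j (σ i j) × j ∈ J σ i)
  preimage-switch {i} g g∈ fix with Fin.<-cmp i (g ⟨$⟩ˡ i)
  ... | tri≈ _ i≡j _ = inj₁ (≡.sym i≡j)
  ... | tri> _ j≢i j<i = contradiction (≡.trans (≡.sym (inverseʳ g)) (fix _ j<i)) j≢i
  ... | tri< i<j i≢j _ = inj₂ (isSwitch , ∈J σ (proj₁ (proj₂ isSwitch)) i≢j)
    where
    isSwitch : IsSwitch G i (g ⟨$⟩ˡ i) (σ i (g ⟨$⟩ˡ i))
    isSwitch = switch i _ i<j (g , g∈ , inverseʳ g , fix)

  fixesBelow-suc : ∀ {i} g → FixesBelow (toℕ i) g → g ⟨$⟩ʳ i ≡ i → FixesBelow (suc (toℕ i)) g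
  fixesBelow-suc g fix gi≡i t (s≤s t≤i) with ℕ.m≤n⇒m<n∨m≡n t≤i
  ... | inj₁ t<i = fix t t<i
  ... | inj₂ t≡i = ≡.subst (λ t → g ⟨$⟩ʳ t ≡ t) (≡.sym (Fin.toℕ-injective t≡i)) gi≡i

  peel : ∀ {i} g → g ∈G → FixesBelow (toℕ i) g →
    ∃ λ a → a ∈ₗ switches i × ∃ λ h → h ∈G × FixesBelow (suc (toℕ i)) h × g ≈ a ∘ₚ h
  peel {i} g g∈ fix with preimage-switch g g∈ fix
  ... | inj₁ j≡i =
    Perm.id , here ≡.refl , g , g∈ ,
    fixesBelow-suc g fix (≡.trans (≡.cong (g ⟨$⟩ʳ_) (≡.sym j≡i)) (inverseʳ g)) , λ _ → ≡.refl
  ... | inj₂ ((s∈ , sj≡i , sfix) , j∈J) =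
    s , there (∈-map⁺ (σ i) (∈-filter⁺ (_∈? J σ i) (∈-allFin _) j∈J)) ,
    -- `∘ₚ` applies its left factor first. Both s and g send j to i and fix everything below i, so
    -- undoing s and then applying g fixes all points up to i.
    flip s ∘ₚ g , ∘∈ (flip∈ s∈) g∈ ,
    fixesBelow-suc (flip s ∘ₚ g)
      (λ t t<i → ≡.trans (≡.cong (g ⟨$⟩ʳ_) (unswitch (sfix t t<i))) (fix t t<i))
      (≡.trans (≡.cong (g ⟨$⟩ʳ_) (unswitch sj≡i)) (inverseʳ g)) ,
    λ x → ≡.cong (g ⟨$⟩ʳ_) (≡.sym (inverseˡ s))
    where
    s : Permutation′ n
    s = σ i (g ⟨$⟩ˡ i)

    unswitch : ∀ {x y} → s ⟨$⟩ʳ x ≡ y → s ⟨$⟩ˡ y ≡ x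
    unswitch sx≡y = ≡.trans (≡.cong (s ⟨$⟩ˡ_) (≡.sym sx≡y)) (inverseˡ s)

  module _ {r : Fin n} (rowsBeyond : ∀ i → r Fin.< i → ¬ Effective σ i) where

    -- Induction upwards through the points: beyond row r there are no switches, so an element that
    -- fixes all smaller points must fix the next one too.
    fixesBelow⇒≈id : ∀ g → g ∈G → FixesBelow (suc (toℕ r)) g → g ≈ Perm.id
    fixesBelow⇒≈id g g∈ fix x = fixesBelow (suc (toℕ x)) x ℕ.≤-refl
      where
      fixesBelow : ∀ s → FixesBelow s g
      fixesBelow (suc s) t (s≤s t≤s)
        with preimage-switch {t} g g∈ (λ u u<t → fixesBelow s u (ℕ.<-≤-trans u<t t≤s))
      ... | inj₁ j≡t = ≡.trans (≡.cong (g ⟨$⟩ʳ_) (≡.sym j≡t)) (inverseʳ g)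
      ... | inj₂ (_ , j∈J) with ℕ.≤-<-connex (toℕ t) (toℕ r)
      ...   | inj₁ t≤r = fix t (s≤s t≤r)
      ...   | inj₂ r<t = contradiction (_ , j∈J) (rowsBeyond t r<t)

  rowProduct : ℕ → ℕ
  rowProduct s = product (map (suc ∘ c σ) (take s (allFin n)))

  rowProduct-suc : ∀ i → rowProduct (suc (toℕ i)) ≡ rowProduct (toℕ i) ℕ.* suc (c σ i)
  rowProduct-suc i = begin
    product (map (suc ∘ c σ) (take (suc (toℕ i)) (allFin n)))
      ≡⟨ ≡.cong (product ∘ map (suc ∘ c σ)) (List.take-suc-tabulate id i) ⟩
    product (map (suc ∘ c σ) (take (toℕ i) (allFin n) ∷ʳ i))
      ≡⟨ ≡.cong product (List.map-++ (suc ∘ c σ) (take (toℕ i) (allFin n)) [ i ]) ⟩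
    product (map (suc ∘ c σ) (take (toℕ i) (allFin n)) ++ [ suc (c σ i) ])
      ≡⟨ product-++ (map (suc ∘ c σ) (take (toℕ i) (allFin n))) [ suc (c σ i) ] ⟩
    rowProduct (toℕ i) ℕ.* (suc (c σ i) ℕ.* 1)
      ≡⟨ ≡.cong (rowProduct (toℕ i) ℕ.*_) (ℕ.*-identityʳ _) ⟩
    rowProduct (toℕ i) ℕ.* suc (c σ i) ∎
    where open ≡.≡-Reasoning

  Factors : ℕ → List (Permutation′ n) → Set p
  Factors s as = ∀ g → g ∈G →
    ∃ λ a → a ∈ₗ as × ∃ λ h → h ∈G × FixesBelow s h × g ≈ a ∘ₚ h

  -- Up to a remaining right factor fixing the first s points, G is covered by the products of one
  -- member of `switches i` for each of the first s rows i.
  factors : ∀ s → s ℕ.≤ n → ∃ λ as → length as ≡ rowProduct s × Factors s as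
  factors zero    _   = [ Perm.id ] , ≡.refl ,
    λ g g∈ → Perm.id , here ≡.refl , g , g∈ , (λ _ ()) , λ _ → ≡.refl
  factors (suc s) s<n = extend (factors s (ℕ.<⇒≤ s<n))
    where
    i : Fin n
    i = fromℕ< s<n

    toℕi≡s : toℕ i ≡ s
    toℕi≡s = Fin.toℕ-fromℕ< s<n

    extend : (∃ λ as → length as ≡ rowProduct s × Factors s as) →
             ∃ λ as → length as ≡ rowProduct (suc s) × Factors (suc s) as
    extend (as , length≡ , factor) = cartesianProductWith _∘ₚ_ as (switches i) , length′ , factor′
      where
      open ≡.≡-Reasoning
      length′ : length (cartesianProductWith _∘ₚ_ as (switches i)) ≡ rowProduct (suc s)
      length′ = begin
        length (cartesianProductWith _∘ₚ_ as (switches i))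
          ≡⟨ length-cartesianProductWith _∘ₚ_ as _ ⟩
        length as ℕ.* length (switches i)
          ≡⟨ ≡.cong₂ ℕ._*_ length≡ (length-switches i) ⟩
        rowProduct s ℕ.* suc (c σ i)
          ≡⟨ ≡.cong (λ s → rowProduct s ℕ.* suc (c σ i)) (≡.sym toℕi≡s) ⟩
        rowProduct (toℕ i) ℕ.* suc (c σ i)
          ≡⟨ rowProduct-suc i ⟨
        rowProduct (suc (toℕ i))
          ≡⟨ ≡.cong (rowProduct ∘ suc) toℕi≡s ⟩
        rowProduct (suc s) ∎

      factor′ : Factors (suc s) (cartesianProductWith _∘ₚ_ as (switches i))
      factor′ g g∈ =
        let a , a∈ , h  , h∈  , fix  , g≈ah  = factor g g∈
            b , b∈ , h′ , h′∈ , fix′ , h≈bh′ =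
              peel {i} h h∈ (≡.subst (λ s → FixesBelow s h) (≡.sym toℕi≡s) fix)
        in a ∘ₚ b , ∈-cartesianProductWith⁺ _∘ₚ_ a∈ b∈ , h′ , h′∈ ,
           ≡.subst (λ s → FixesBelow (suc s) h′) toℕi≡s fix′ ,
           λ x → ≡.trans (g≈ah x) (h≈bh′ (a ⟨$⟩ʳ x))

  -- After r rows the remaining factor is the identity, so every element equals one of the listed
  -- products. Its position in that list determines it pointwise, and the enumeration of G is
  -- injective up to pointwise equality.
  order≤ : ∀ {r} → (∀ i → r Fin.< i → ¬ Effective σ i) → order ℕ.≤ rowProduct (index r)
  order≤ {r} rowsBeyond =
    let as , length≡ , factor = factors (suc (toℕ r)) (Fin.toℕ<n r)
    in ≡.subst (order ℕ.≤_) length≡ (Fin.injective⇒≤ (position-injective as factor))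
    where
    perm : Fin order → Permutation′ n
    perm k = proj₁ (Inverse.to enumeration k)

    module _ (as : List (Permutation′ n)) (factor : Factors (suc (toℕ r)) as) where

      representative : ∀ k → ∃ λ a → a ∈ₗ as × perm k ≈ a
      representative k =
        let a , a∈ , h , h∈ , fix , ≈ah = factor (perm k) (proj₂ (Inverse.to enumeration k))
        in a , a∈ , λ x → ≡.trans (≈ah x) (fixesBelow⇒≈id rowsBeyond h h∈ fix (a ⟨$⟩ʳ x))

      position : Fin order → Fin (length as)
      position k = Any.index (proj₁ (proj₂ (representative k)))

      perm≈lookup : ∀ k → perm k ≈ List.lookup as (position k)
      perm≈lookup k x = let a , a∈ , ≈a = representative k in
        ≡.trans (≈a x) (≡.cong (λ (π : Permutation′ n) → π ⟨$⟩ʳ x)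
                        {a} {List.lookup as (position k)} (lookup-index a∈))

      position-injective : ∀ {k l} → position k ≡ position l → k ≡ l
      position-injective {k} {l} eq = ≡.trans (≡.sym (strictlyInverseʳ k))
        (≡.trans (from-cong λ x → ≡.trans (perm≈lookup k x)
          (≡.trans (≡.cong (λ p → List.lookup as p ⟨$⟩ʳ x) eq) (≡.sym (perm≈lookup l x))))
          (strictlyInverseʳ l))
        where open Inverse enumeration using (strictlyInverseʳ; from-cong)

-- Counting subsets

-- The additive form of (k + 1) C(n, k + 1) = (n - k) C(n, k). Without truncated subtraction it
-- follows by induction from Pascal's rule: regrouping leaves the instances for (n, k + 1) and (n,
-- k).
nCk-weighted-pascal : ∀ n k → suc k ℕ.* (n C suc k) ℕ.+ k ℕ.* (n C k) ≡ n ℕ.* (n C k)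
nCk-weighted-pascal zero    zero    = ≡.refl
nCk-weighted-pascal zero    (suc k) =
  ≡.cong₂ ℕ._+_ (ℕ.*-zeroʳ (suc (suc k))) (ℕ.*-zeroʳ (suc k))
nCk-weighted-pascal (suc n) zero    = ≡.trans (ℕ.+-identityʳ _)
  (≡.trans (ℕ.+-identityʳ _) (≡.trans (nC1≡n (suc n)) (≡.sym (ℕ.*-identityʳ (suc n)))))
nCk-weighted-pascal (suc n) (suc k)
  rewrite ≡.sym (nCk+nC[k+1]≡[n+1]C[k+1] n k) | ≡.sym (nCk+nC[k+1]≡[n+1]C[k+1] n (suc k)) = begin
  suc (suc k) ℕ.* (y ℕ.+ z) ℕ.+ suc k ℕ.* (x ℕ.+ y)
    ≡⟨ regroup k x y z ⟩
  (suc (suc k) ℕ.* z ℕ.+ suc k ℕ.* y) ℕ.+ y ℕ.+ (suc k ℕ.* y ℕ.+ k ℕ.* x) ℕ.+ x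
    ≡⟨ ≡.cong₂ (λ u v → u ℕ.+ y ℕ.+ v ℕ.+ x) (nCk-weighted-pascal n (suc k))
         (nCk-weighted-pascal n k) ⟩
  n ℕ.* y ℕ.+ y ℕ.+ n ℕ.* x ℕ.+ x
    ≡⟨ collect n x y ⟩
  suc n ℕ.* (x ℕ.+ y) ∎
  where
  open ≡.≡-Reasoning
  x = n C k
  y = n C suc k
  z = n C suc (suc k)
  regroup : ∀ k x y z →
    suc (suc k) ℕ.* (y ℕ.+ z) ℕ.+ suc k ℕ.* (x ℕ.+ y) ≡
    (suc (suc k) ℕ.* z ℕ.+ suc k ℕ.* y) ℕ.+ y ℕ.+ (suc k ℕ.* y ℕ.+ k ℕ.* x) ℕ.+ x
  regroup = solve-∀
  collect : ∀ n x y → n ℕ.* y ℕ.+ y ℕ.+ n ℕ.* x ℕ.+ x ≡ suc n ℕ.* (x ℕ.+ y)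
  collect = solve-∀

[k+1]*nC[k+1]≡[n∸k]*nCk : ∀ n k → suc k ℕ.* (n C suc k) ≡ (n ℕ.∸ k) ℕ.* (n C k)
[k+1]*nC[k+1]≡[n∸k]*nCk n k = begin
  suc k ℕ.* (n C suc k)
    ≡⟨ ℕ.m+n∸n≡m _ (k ℕ.* (n C k)) ⟨
  suc k ℕ.* (n C suc k) ℕ.+ k ℕ.* (n C k) ℕ.∸ k ℕ.* (n C k)
    ≡⟨ ≡.cong (ℕ._∸ k ℕ.* (n C k)) (nCk-weighted-pascal n k) ⟩
  n ℕ.* (n C k) ℕ.∸ k ℕ.* (n C k)
    ≡⟨ ℕ.*-distribʳ-∸ (n C k) n k ⟨
  (n ℕ.∸ k) ℕ.* (n C k) ∎
  where open ≡.≡-Reasoning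

-- With N = n + 1 this says C(N - 1, k) / C(N, k) = (N - k) / N, the probability that a random
-- k-subset omits a given point. Adding k C(n, k) to both sides reduces it to Pascal's rule and the
-- two preceding identities.
[n+1]*nCk≡[n+1∸k]*[n+1]Ck : ∀ n k → suc n ℕ.* (n C k) ≡ (suc n ℕ.∸ k) ℕ.* (suc n C k)
[n+1]*nCk≡[n+1∸k]*[n+1]Ck n k = ℕ.+-cancelʳ-≡ (k ℕ.* (n C k)) _ _ (begin
  suc n ℕ.* x ℕ.+ k ℕ.* x
    ≡⟨ shift n k x ⟩
  x ℕ.+ (n ℕ.* x ℕ.+ k ℕ.* x)
    ≡⟨ ≡.cong (λ u → x ℕ.+ (u ℕ.+ k ℕ.* x)) (nCk-weighted-pascal n k) ⟨
  x ℕ.+ (suc k ℕ.* y ℕ.+ k ℕ.* x ℕ.+ k ℕ.* x)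
    ≡⟨ regroup k x y ⟩
  suc k ℕ.* (x ℕ.+ y) ℕ.+ k ℕ.* x
    ≡⟨ ≡.cong (λ u → suc k ℕ.* u ℕ.+ k ℕ.* x) (nCk+nC[k+1]≡[n+1]C[k+1] n k) ⟩
  suc k ℕ.* (suc n C suc k) ℕ.+ k ℕ.* x
    ≡⟨ ≡.cong (ℕ._+ k ℕ.* x) ([k+1]*nC[k+1]≡[n∸k]*nCk (suc n) k) ⟩
  (suc n ℕ.∸ k) ℕ.* (suc n C k) ℕ.+ k ℕ.* x ∎)
  where
  open ≡.≡-Reasoning
  x = n C k
  y = n C suc k
  shift : ∀ n k x → suc n ℕ.* x ℕ.+ k ℕ.* x ≡ x ℕ.+ (n ℕ.* x ℕ.+ k ℕ.* x)
  shift = solve-∀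
  regroup : ∀ k x y → x ℕ.+ (suc k ℕ.* y ℕ.+ k ℕ.* x ℕ.+ k ℕ.* x) ≡ suc k ℕ.* (x ℕ.+ y) ℕ.+ k ℕ.* x
  regroup = solve-∀

0<nCk : ∀ {n k} → k ℕ.≤ n → 0 ℕ.< n C k
0<nCk {n}     {zero}  _         = ℕ.≤-refl
0<nCk {suc n} {suc k} (s≤s k≤n) =
  ≡.subst (0 ℕ.<_) (nCk+nC[k+1]≡[n+1]C[k+1] n k) (ℕ.≤-trans (0<nCk k≤n) (ℕ.m≤m+n (n C k) _))

module _ {a p} {A : Set a} {P : Pred A p} (P? : Decidable P) where

  count : List A → ℕ
  count xs = length (filter P? xs)

  count-++ : ∀ xs ys → count (xs ++ ys) ≡ count xs ℕ.+ count ys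
  count-++ xs ys = ≡.trans (≡.cong length (List.filter-++ P? xs ys)) (List.length-++ (filter P? xs))

  count-map : ∀ {b} {B : Set b} (f : B → A) xs → count (map f xs) ≡ length (filter (P? ∘ f) xs)
  count-map f []       = ≡.refl
  count-map f (x ∷ xs) with does (P? (f x))
  ... | true  = ≡.cong suc (count-map f xs)
  ... | false = count-map f xs

  count-none : (∀ x → ¬ P x) → ∀ xs → count xs ≡ 0
  count-none ¬P xs = ≡.cong length (List.filter-none P? (All.universal ¬P xs))

count-≐ : ∀ {a p q} {A : Set a} {P : Pred A p} {Q : Pred A q}
          (P? : Decidable P) (Q? : Decidable Q) → P ≐ Q → ∀ xs → count P? xs ≡ count Q? xs
count-≐ P? Q? P≐Q xs = ≡.cong length (List.filter-≐ P? Q? P≐Q xs)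

count-filter : ∀ {a p q} {A : Set a} {P : Pred A p} {Q : Pred A q}
               (P? : Decidable P) (Q? : Decidable Q) →
               ∀ xs → count P? (filter Q? xs) ≡ count (λ x → P? x ×-dec Q? x) xs
count-filter P? Q? []       = ≡.refl
count-filter P? Q? (x ∷ xs) with does (Q? x)
... | false with does (P? x)
...   | true  = count-filter P? Q? xs
...   | false = count-filter P? Q? xs
count-filter P? Q? (x ∷ xs) | true with does (P? x)
...   | true  = ≡.cong suc (count-filter P? Q? xs)
...   | false = count-filter P? Q? xs

SizedSubsetOf : Subset n → ℕ → Subset n → Set
SizedSubsetOf U k S = S ⊆ U × ∣ S ∣ ≡ k

sizedSubsetOf? : (U : Subset n) (k : ℕ) → Decidable (SizedSubsetOf U k)
sizedSubsetOf? U k S = S ⊆? U ×-dec ∣ S ∣ ℕ.≟ k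

-- Splitting on the first point is Pascal's rule. The samples at level i, those omitting i and those
-- also avoiding J(i) are all the k-subsets of a suitable U, so this single count serves all three.
count-sizedSubsets : ∀ (U : Subset n) k → count (sizedSubsetOf? U k) (allSubsets n) ≡ ∣ U ∣ C k
count-sizedSubsets {zero}  []      zero    = ≡.refl
count-sizedSubsets {zero}  []      (suc k) = ≡.refl
count-sizedSubsets {suc n} (u ∷ U) k = begin
  count (sizedSubsetOf? (u ∷ U) k) (map (inside ∷_) (allSubsets n) ++ map (outside ∷_) (allSubsets n))
    ≡⟨ count-++ _ (map (inside ∷_) (allSubsets n)) _ ⟩
  count (sizedSubsetOf? (u ∷ U) k) (map (inside ∷_) (allSubsets n)) ℕ.+
  count (sizedSubsetOf? (u ∷ U) k) (map (outside ∷_) (allSubsets n))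
    ≡⟨ ≡.cong₂ ℕ._+_ (≡.trans (count-map _ (inside ∷_) (allSubsets n)) (withHead u k))
         (≡.trans (count-map _ (outside ∷_) (allSubsets n)) withoutHead) ⟩
  headCount u k ℕ.+ ∣ U ∣ C k
    ≡⟨ total u k ⟩
  ∣ u ∷ U ∣ C k ∎
  where
  open ≡.≡-Reasoning
  headCount : ∀ u k → ℕ
  headCount inside  (suc k) = ∣ U ∣ C k
  headCount _       _       = 0

  withHead : ∀ u k →
    count (λ S → sizedSubsetOf? (u ∷ U) k (inside ∷ S)) (allSubsets n) ≡ headCount u k
  withHead outside k       = count-none _ (λ { _ (S⊆ , _) → head∉ (S⊆ here) }) (allSubsets n)
    where
    head∉ : Fin.zero ∉ outside ∷ U
    head∉ ()
  withHead inside  zero    = count-none _ (λ { _ (_ , ()) }) (allSubsets n)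
  withHead inside  (suc k) = ≡.trans
    (count-≐ (λ S → sizedSubsetOf? (inside ∷ U) (suc k) (inside ∷ S)) (sizedSubsetOf? U k)
      ((λ (S⊆ , size) → drop-∷-⊆ S⊆ , ℕ.suc-injective size) ,
       (λ (S⊆ , size) → in⊆in S⊆ , ≡.cong suc size)) (allSubsets n))
    (count-sizedSubsets U k)

  withoutHead : count (λ S → sizedSubsetOf? (u ∷ U) k (outside ∷ S)) (allSubsets n) ≡ ∣ U ∣ C k
  withoutHead = ≡.trans
    (count-≐ (λ S → sizedSubsetOf? (u ∷ U) k (outside ∷ S)) (sizedSubsetOf? U k)
      ((λ (S⊆ , size) → drop-∷-⊆ S⊆ , size) , (λ (S⊆ , size) → out⊆ S⊆ , size)) (allSubsets n))
    (count-sizedSubsets U k)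

  total : ∀ u k → headCount u k ℕ.+ ∣ U ∣ C k ≡ ∣ u ∷ U ∣ C k
  total inside  zero    = ≡.refl
  total inside  (suc k) = nCk+nC[k+1]≡[n+1]C[k+1] ∣ U ∣ k
  total outside k       = ≡.refl

-- Thresholds are zero-based: s = `toℕ i` gives the points from i on, and s = `suc (toℕ i)` the
-- points strictly beyond i.
above : ∀ n → ℕ → Subset n
above n s = Vec.tabulate (λ x → does (s ℕ.≤? toℕ x))

∣above∣ : ∀ n s → ∣ above n s ∣ ≡ n ℕ.∸ s
∣above∣ zero    zero    = ≡.refl
∣above∣ zero    (suc s) = ≡.refl
∣above∣ (suc n) zero          = ≡.cong suc (∣above∣ n zero)
∣above∣ (suc n) (suc zero)    = ∣above∣ n zero
∣above∣ (suc n) (suc (suc s)) = ∣above∣ n (suc s)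

∈above⁺ : ∀ {s} {x : Fin n} → s ℕ.≤ toℕ x → x ∈ above n s
∈above⁺ {s = s} {x} s≤x = Vec.lookup⇒[]= x _
  (≡.trans (Vec.lookup∘tabulate _ x) (dec-true (s ℕ.≤? toℕ x) s≤x))

∈above⁻ : ∀ {s} {x : Fin n} → x ∈ above n s → s ℕ.≤ toℕ x
∈above⁻ {s = s} {x} x∈ with s ℕ.≤? toℕ x in eq
... | yes s≤x = s≤x
... | no s≰x = contradiction
  (≡.trans (≡.sym (Vec.[]=⇒lookup x∈))
    (≡.trans (Vec.lookup∘tabulate _ x) (dec-false (s ℕ.≤? toℕ x) s≰x))) λ ()

∣p∣≤∣p─q∣+∣q∣ : ∀ (p q : Subset n) → ∣ p ∣ ℕ.≤ ∣ p ─ q ∣ ℕ.+ ∣ q ∣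
∣p∣≤∣p─q∣+∣q∣ []            []            = z≤n
∣p∣≤∣p─q∣+∣q∣ (inside  ∷ p) (inside  ∷ q) =
  ≡.subst (suc ∣ p ∣ ℕ.≤_) (≡.sym (ℕ.+-suc ∣ p ─ q ∣ ∣ q ∣)) (s≤s (∣p∣≤∣p─q∣+∣q∣ p q))
∣p∣≤∣p─q∣+∣q∣ (inside  ∷ p) (outside ∷ q) = s≤s (∣p∣≤∣p─q∣+∣q∣ p q)
∣p∣≤∣p─q∣+∣q∣ (outside ∷ p) (inside  ∷ q) =
  ℕ.≤-trans (∣p∣≤∣p─q∣+∣q∣ p q) (ℕ.+-monoʳ-≤ ∣ p ─ q ∣ (ℕ.n≤1+n ∣ q ∣))
∣p∣≤∣p─q∣+∣q∣ (outside ∷ p) (outside ∷ q) = ∣p∣≤∣p─q∣+∣q∣ p q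

x∈p─q⇒x∉q : ∀ (p q : Subset n) {x} → x ∈ p ─ q → x ∉ q
x∈p─q⇒x∉q (_ ∷ p) (outside ∷ q) (there x∈) (there x∈q) = x∈p─q⇒x∉q p q x∈ x∈q
x∈p─q⇒x∉q (_ ∷ p) (inside  ∷ q) (there x∈) (there x∈q) = x∈p─q⇒x∉q p q x∈ x∈q

module _ (i : Fin n) (k : ℕ) where

  length-subsetsFrom : length (subsetsFrom i k) ≡ (n ℕ.∸ toℕ i) C k
  length-subsetsFrom = begin
    length (subsetsFrom i k)
      ≡⟨ count-≐ (λ S → Lift? (i Fin.≤?_) S ×-dec (∣ S ∣ ℕ.≟ k))
           (sizedSubsetOf? (above n (toℕ i)) k)
           ((λ (lift , size) → (λ x∈ → ∈above⁺ (lift x∈)) , size) ,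
            (λ (S⊆ , size) → (λ x∈ → ∈above⁻ (S⊆ x∈)) , size)) (allSubsets n) ⟩
    count (sizedSubsetOf? (above n (toℕ i)) k) (allSubsets n)
      ≡⟨ count-sizedSubsets (above n (toℕ i)) k ⟩
    ∣ above n (toℕ i) ∣ C k
      ≡⟨ ≡.cong (_C k) (∣above∣ n (toℕ i)) ⟩
    (n ℕ.∸ toℕ i) C k ∎
    where open ≡.≡-Reasoning

  -- For V = J(i), the condition on S′ under which the non-element branch does not return early.
  Avoids : Subset n → Subset n → Set
  Avoids V S = i ∉ S × ¬ Nonempty (V ∩ S)

  avoids? : ∀ V → Decidable (Avoids V)
  avoids? V S = ¬? (i ∈? S) ×-dec ¬? (nonempty? (V ∩ S))

  private
    strictlyAbove : ∀ {S} → Lift (i Fin.≤_) S → i ∉ S → S ⊆ above n (suc (toℕ i))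
    strictlyAbove {S} lift i∉S x∈S = ∈above⁺ (ℕ.≤∧≢⇒< (lift x∈S) λ i≡x →
      i∉S (≡.subst (_∈ S) (≡.sym (Fin.toℕ-injective i≡x)) x∈S))

    i∉above : ∀ {S} → S ⊆ above n (suc (toℕ i)) → i ∉ S
    i∉above S⊆ i∈S = ℕ.<-irrefl ≡.refl (∈above⁻ (S⊆ i∈S))

    lift-above : ∀ {S} → S ⊆ above n (suc (toℕ i)) → Lift (i Fin.≤_) S
    lift-above S⊆ x∈S = ℕ.<⇒≤ (∈above⁻ (S⊆ x∈S))

  count-∌ : count (λ S → ¬? (i ∈? S)) (subsetsFrom i k) ≡ (n ℕ.∸ suc (toℕ i)) C k
  count-∌ = begin
    count (λ S → ¬? (i ∈? S)) (subsetsFrom i k)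
      ≡⟨ count-filter (λ S → ¬? (i ∈? S))
           (λ S → Lift? (i Fin.≤?_) S ×-dec (∣ S ∣ ℕ.≟ k)) (allSubsets n) ⟩
    count (λ S → ¬? (i ∈? S) ×-dec (Lift? (i Fin.≤?_) S ×-dec (∣ S ∣ ℕ.≟ k))) (allSubsets n)
      ≡⟨ count-≐ (λ S → ¬? (i ∈? S) ×-dec (Lift? (i Fin.≤?_) S ×-dec (∣ S ∣ ℕ.≟ k)))
           (sizedSubsetOf? (above n (suc (toℕ i))) k)
           ((λ (i∉S , lift , size) → strictlyAbove lift i∉S , size) ,
            (λ (S⊆ , size) → i∉above S⊆ , lift-above S⊆ , size)) (allSubsets n) ⟩
    count (sizedSubsetOf? (above n (suc (toℕ i))) k) (allSubsets n)
      ≡⟨ count-sizedSubsets (above n (suc (toℕ i))) k ⟩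
    ∣ above n (suc (toℕ i)) ∣ C k
      ≡⟨ ≡.cong (_C k) (∣above∣ n (suc (toℕ i))) ⟩
    (n ℕ.∸ suc (toℕ i)) C k ∎
    where open ≡.≡-Reasoning

  count-avoiding : ∀ V → count (avoids? V) (subsetsFrom i k) ≡ ∣ above n (suc (toℕ i)) ─ V ∣ C k
  count-avoiding V = begin
    count (avoids? V) (subsetsFrom i k)
      ≡⟨ count-filter (avoids? V) (λ S → Lift? (i Fin.≤?_) S ×-dec (∣ S ∣ ℕ.≟ k)) (allSubsets n) ⟩
    count (λ S → avoids? V S ×-dec (Lift? (i Fin.≤?_) S ×-dec (∣ S ∣ ℕ.≟ k))) (allSubsets n)
      ≡⟨ count-≐ (λ S → avoids? V S ×-dec (Lift? (i Fin.≤?_) S ×-dec (∣ S ∣ ℕ.≟ k)))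
           (sizedSubsetOf? (A ─ V) k)
           ((λ ((i∉S , disjoint) , lift , size) →
              (λ x∈S → Subset.x∈p∧x∉q⇒x∈p─q (strictlyAbove lift i∉S x∈S)
                         λ x∈V → disjoint (_ , Subset.x∈p∩q⁺ (x∈V , x∈S))) , size) ,
            (λ (S⊆ , size) →
              (i∉above (A⊇ S⊆) , λ (x , x∈) → let x∈V , x∈S = Subset.x∈p∩q⁻ V _ x∈ in
                 x∈p─q⇒x∉q A V (S⊆ x∈S) x∈V) ,
              lift-above (A⊇ S⊆) , size)) (allSubsets n) ⟩
    count (sizedSubsetOf? (A ─ V) k) (allSubsets n)
      ≡⟨ count-sizedSubsets (A ─ V) k ⟩
    ∣ A ─ V ∣ C k ∎
    where
    open ≡.≡-Reasoning
    A = above n (suc (toℕ i))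
    A⊇ : ∀ {S} → S ⊆ A ─ V → S ⊆ A
    A⊇ S⊆ x∈S = Subset.p─q⊆p A V (S⊆ x∈S)

  -- Discarding i and V loses at most |V| + 1 of the N points. The shape N ≤ u + d, with d = |V| +
  -- 1, is what the estimate of C(u, m) / C(N, m) takes as input.
  n∸i≤avoiding+∣V∣ : ∀ V → n ℕ.∸ toℕ i ℕ.≤ ∣ above n (suc (toℕ i)) ─ V ∣ ℕ.+ suc ∣ V ∣
  n∸i≤avoiding+∣V∣ V = begin
    n ℕ.∸ toℕ i
      ≤⟨ ℕ.≤-reflexive (ℕ.+-∸-assoc 1 (Fin.toℕ<n i)) ⟩
    suc (n ℕ.∸ suc (toℕ i))
      ≡⟨ ≡.cong suc (∣above∣ n (suc (toℕ i))) ⟨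
    suc ∣ above n (suc (toℕ i)) ∣
      ≤⟨ s≤s (∣p∣≤∣p─q∣+∣q∣ (above n (suc (toℕ i))) V) ⟩
    suc (∣ above n (suc (toℕ i)) ─ V ∣ ℕ.+ ∣ V ∣)
      ≡⟨ ℕ.+-suc _ ∣ V ∣ ⟨
    ∣ above n (suc (toℕ i)) ─ V ∣ ℕ.+ suc ∣ V ∣ ∎
    where open ℕ.≤-Reasoning

-- Expected cost

toℚᵘ-fromℕℚ : ∀ a → toℚᵘ (fromℕℚ a) ℚᵘ.≃ mkℚᵘ (+ a) 0
toℚᵘ-fromℕℚ a = ℚ.toℚᵘ-fromℚᵘ (mkℚᵘ (+ a) 0)

fromℕℚ-homo-+ : ∀ a b → fromℕℚ (a ℕ.+ b) ≡ fromℕℚ a ℚ.+ fromℕℚ b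
fromℕℚ-homo-+ a b = ℚ.toℚᵘ-injective (begin
  toℚᵘ (fromℕℚ (a ℕ.+ b))
    ≈⟨ toℚᵘ-fromℕℚ (a ℕ.+ b) ⟩
  mkℚᵘ (+ (a ℕ.+ b)) 0
    ≈⟨ *≡* (≡.cong (ℤ._* ℤ.1ℤ) (≡.sym (≡.cong₂ ℤ._+_ (ℤ.*-identityʳ (+ a)) (ℤ.*-identityʳ (+ b))))) ⟩
  mkℚᵘ (+ a) 0 ℚᵘ.+ mkℚᵘ (+ b) 0
    ≈⟨ ℚᵘ.+-cong (toℚᵘ-fromℕℚ a) (toℚᵘ-fromℕℚ b) ⟨
  toℚᵘ (fromℕℚ a) ℚᵘ.+ toℚᵘ (fromℕℚ b)
    ≈⟨ ℚ.toℚᵘ-homo-+ (fromℕℚ a) (fromℕℚ b) ⟨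
  toℚᵘ (fromℕℚ a ℚ.+ fromℕℚ b) ∎)
  where open ℚᵘ.≃-Reasoning

fromℕℚ-homo-* : ∀ a b → fromℕℚ (a ℕ.* b) ≡ fromℕℚ a ℚ.* fromℕℚ b
fromℕℚ-homo-* a b = ℚ.toℚᵘ-injective (begin
  toℚᵘ (fromℕℚ (a ℕ.* b))               ≈⟨ toℚᵘ-fromℕℚ (a ℕ.* b) ⟩
  mkℚᵘ (+ (a ℕ.* b)) 0                  ≈⟨ *≡* (≡.cong (ℤ._* ℤ.1ℤ) (ℤ.pos-* a b)) ⟩
  mkℚᵘ (+ a) 0 ℚᵘ.* mkℚᵘ (+ b) 0        ≈⟨ ℚᵘ.*-cong (toℚᵘ-fromℕℚ a) (toℚᵘ-fromℕℚ b) ⟨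
  toℚᵘ (fromℕℚ a) ℚᵘ.* toℚᵘ (fromℕℚ b)  ≈⟨ ℚ.toℚᵘ-homo-* (fromℕℚ a) (fromℕℚ b) ⟨
  toℚᵘ (fromℕℚ a ℚ.* fromℕℚ b)          ∎)
  where open ℚᵘ.≃-Reasoning

fromℕℚ-mono-≤ : ∀ {a b} → a ℕ.≤ b → fromℕℚ a ℚ.≤ fromℕℚ b
fromℕℚ-mono-≤ {a} {b} a≤b = ℚ.toℚᵘ-cancel-≤ (begin
  toℚᵘ (fromℕℚ a)  ≃⟨ toℚᵘ-fromℕℚ a ⟩
  mkℚᵘ (+ a) 0     ≤⟨ *≤* (ℤ.*-monoʳ-≤-nonNeg ℤ.1ℤ (ℤ.+≤+ a≤b)) ⟩
  mkℚᵘ (+ b) 0     ≃⟨ toℚᵘ-fromℕℚ b ⟨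
  toℚᵘ (fromℕℚ b)  ∎)
  where open ℚᵘ.≤-Reasoning

fromℕℚ-nonNeg : ∀ a → ℚ.NonNegative (fromℕℚ a)
fromℕℚ-nonNeg a = ℚ.normalize-nonNeg a 1

0≤fromℕℚ : ∀ a → 0ℚ ℚ.≤ fromℕℚ a
0≤fromℕℚ a = ℚ.nonNegative⁻¹ (fromℕℚ a) {{fromℕℚ-nonNeg a}}

fromℕℚ-suc : ∀ a → fromℕℚ (suc a) ≡ 1ℚ ℚ.+ fromℕℚ a
fromℕℚ-suc = fromℕℚ-homo-+ 1

fromℕℚ-inverse : ∀ a .{{_ : ℕ.NonZero a}} → fromℕℚ a ℚ.* (+ 1 / a) ≡ 1ℚ
fromℕℚ-inverse (suc a) = ℚ.toℚᵘ-injective (begin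
  toℚᵘ (fromℕℚ (suc a) ℚ.* (+ 1 / suc a))
    ≈⟨ ℚ.toℚᵘ-homo-* (fromℕℚ (suc a)) (+ 1 / suc a) ⟩
  toℚᵘ (fromℕℚ (suc a)) ℚᵘ.* toℚᵘ (+ 1 / suc a)
    ≈⟨ ℚᵘ.*-cong (toℚᵘ-fromℕℚ (suc a)) (ℚ.toℚᵘ-fromℚᵘ (mkℚᵘ (+ 1) a)) ⟩
  mkℚᵘ (+ suc a) 0 ℚᵘ.* mkℚᵘ (+ 1) a
    ≈⟨ *≡* (≡.trans (ℤ.*-identityʳ _)
         (≡.trans (ℤ.*-identityʳ (+ suc a))
           (≡.sym (≡.trans (ℤ.*-identityˡ _) (ℤ.*-identityˡ (+ suc a)))))) ⟩
  toℚᵘ 1ℚ ∎)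
  where open ℚᵘ.≃-Reasoning

+-nonNeg : ∀ {x y} → 0ℚ ℚ.≤ x → 0ℚ ℚ.≤ y → 0ℚ ℚ.≤ x ℚ.+ y
+-nonNeg 0≤x 0≤y = ℚ.+-mono-≤ 0≤x 0≤y

*-nonNeg : ∀ {x y} → 0ℚ ℚ.≤ x → 0ℚ ℚ.≤ y → 0ℚ ℚ.≤ x ℚ.* y
*-nonNeg {x} {y} 0≤x 0≤y =
  ≡.subst (ℚ._≤ x ℚ.* y) (ℚ.*-zeroʳ x) (ℚ.*-monoˡ-≤-nonNeg x {{ℚ.nonNegative 0≤x}} 0≤y)

-- Sums and means of lists of rationals

sumℚ-++ : ∀ xs ys → sumℚ (xs ++ ys) ≡ sumℚ xs ℚ.+ sumℚ ys
sumℚ-++ []       ys = ≡.sym (ℚ.+-identityˡ (sumℚ ys))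
sumℚ-++ (x ∷ xs) ys = ≡.trans (≡.cong (x ℚ.+_) (sumℚ-++ xs ys))
  (≡.sym (ℚ.+-assoc x (sumℚ xs) (sumℚ ys)))

sumℚ-nonNeg : ∀ {a} {A : Set a} {f : A → ℚ} → (∀ x → 0ℚ ℚ.≤ f x) → ∀ xs → 0ℚ ℚ.≤ sumℚ (map f xs)
sumℚ-nonNeg 0≤f []       = ℚ.≤-refl
sumℚ-nonNeg 0≤f (x ∷ xs) = +-nonNeg (0≤f x) (sumℚ-nonNeg 0≤f xs)

sumℚ-constant : ∀ {a} {A : Set a} {f : A → ℚ} {v} → (∀ x → f x ≡ v) →
                ∀ xs → sumℚ (map f xs) ≡ fromℕℚ (length xs) ℚ.* v
sumℚ-constant {v = v} f≡v []       = ≡.sym (ℚ.*-zeroˡ v)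
sumℚ-constant {f = f} {v} f≡v (x ∷ xs) = begin
  f x ℚ.+ sumℚ (map f xs)
    ≡⟨ ≡.cong₂ ℚ._+_ (≡.trans (f≡v x) (≡.sym (ℚ.*-identityˡ v))) (sumℚ-constant f≡v xs) ⟩
  1ℚ ℚ.* v ℚ.+ fromℕℚ (length xs) ℚ.* v
    ≡⟨ ℚ.*-distribʳ-+ v 1ℚ (fromℕℚ (length xs)) ⟨
  (1ℚ ℚ.+ fromℕℚ (length xs)) ℚ.* v
    ≡⟨ ≡.cong (ℚ._* v) (fromℕℚ-suc (length xs)) ⟨
  fromℕℚ (suc (length xs)) ℚ.* v ∎
  where open ≡.≡-Reasoning

length*mean≡sum : ∀ xs → fromℕℚ (length xs) ℚ.* mean xs ≡ sumℚ xs
-- The default value of `mean` on the empty list is multiplied by length zero.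
length*mean≡sum []       = ≡.refl
length*mean≡sum (x ∷ xs) = begin
  l ℚ.* (s ℚ.* (+ 1 / suc (length xs)))  ≡⟨ ≡.cong (l ℚ.*_) (ℚ.*-comm s _) ⟩
  l ℚ.* ((+ 1 / suc (length xs)) ℚ.* s)  ≡⟨ ℚ.*-assoc l _ s ⟨
  l ℚ.* (+ 1 / suc (length xs)) ℚ.* s    ≡⟨ ≡.cong (ℚ._* s) (fromℕℚ-inverse (suc (length xs))) ⟩
  1ℚ ℚ.* s                               ≡⟨ ℚ.*-identityˡ s ⟩
  s                                      ∎
  where
  open ≡.≡-Reasoning
  l = fromℕℚ (suc (length xs))
  s = sumℚ (x ∷ xs)

mean-nonNeg : ∀ {a} {A : Set a} {f : A → ℚ} → (∀ x → 0ℚ ℚ.≤ f x) → ∀ xs → 0ℚ ℚ.≤ mean (map f xs)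
mean-nonNeg 0≤f []       = ℚ.≤-refl
mean-nonNeg 0≤f (x ∷ xs) = *-nonNeg (sumℚ-nonNeg 0≤f (x ∷ xs))
  (ℚ.nonNegative⁻¹ _ {{ℚ.normalize-nonNeg 1 (suc (length (map _ xs)))}})

count*≤sum : ∀ {a p} {A : Set a} {P : Pred A p} (P? : Decidable P) {f : A → ℚ} {v} →
             (∀ x → 0ℚ ℚ.≤ f x) → ∀ xs → (∀ x → x ∈ₗ xs → P x → v ℚ.≤ f x) →
             fromℕℚ (count P? xs) ℚ.* v ℚ.≤ sumℚ (map f xs)
count*≤sum P? {f} {v} 0≤f []       v≤f = ℚ.≤-reflexive (ℚ.*-zeroˡ v)
count*≤sum P? {f} {v} 0≤f (x ∷ xs) v≤f
  with P? x | count*≤sum P? {f} 0≤f xs (λ y → v≤f y ∘ there)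
... | no  _  | ih = ℚ.≤-trans (ℚ.≤-reflexive (≡.sym (ℚ.+-identityˡ _))) (ℚ.+-mono-≤ (0≤f x) ih)
... | yes Px | ih = begin
  fromℕℚ (suc (count P? xs)) ℚ.* v
    ≡⟨ ≡.cong (ℚ._* v) (fromℕℚ-suc (count P? xs)) ⟩
  (1ℚ ℚ.+ fromℕℚ (count P? xs)) ℚ.* v
    ≡⟨ ℚ.*-distribʳ-+ v 1ℚ (fromℕℚ (count P? xs)) ⟩
  1ℚ ℚ.* v ℚ.+ fromℕℚ (count P? xs) ℚ.* v
    ≡⟨ ≡.cong (ℚ._+ fromℕℚ (count P? xs) ℚ.* v) (ℚ.*-identityˡ v) ⟩
  v ℚ.+ fromℕℚ (count P? xs) ℚ.* v
    ≤⟨ ℚ.+-mono-≤ (v≤f x (here ≡.refl) Px) ih ⟩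
  f x ℚ.+ sumℚ (map f xs) ∎
  where
  open ℚ.≤-Reasoning

-- Independence of S and S′ enters here: as an iterated sum, the total can be bounded first over S′
-- for fixed S and then over S.
sumℚ-cartesianProduct : ∀ {a b} {A : Set a} {B : Set b} (f : A × B → ℚ) xs ys →
  sumℚ (map f (cartesianProduct xs ys)) ≡ sumℚ (map (λ x → sumℚ (map (λ y → f (x , y)) ys)) xs)
sumℚ-cartesianProduct f []       ys = ≡.refl
sumℚ-cartesianProduct f (x ∷ xs) ys = begin
  sumℚ (map f (map (x ,_) ys ++ cartesianProduct xs ys))
    ≡⟨ ≡.cong sumℚ (List.map-++ f (map (x ,_) ys) (cartesianProduct xs ys)) ⟩
  sumℚ (map f (map (x ,_) ys) ++ map f (cartesianProduct xs ys))
    ≡⟨ sumℚ-++ (map f (map (x ,_) ys)) _ ⟩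
  sumℚ (map f (map (x ,_) ys)) ℚ.+ sumℚ (map f (cartesianProduct xs ys))
    ≡⟨ ≡.cong₂ ℚ._+_ (≡.cong sumℚ (≡.sym (List.map-∘ ys))) (sumℚ-cartesianProduct f xs ys) ⟩
  sumℚ (map (λ x → sumℚ (map (λ y → f (x , y)) ys)) (x ∷ xs)) ∎
  where open ≡.≡-Reasoning

-- The cost of a single call and its expectation

module _ (σ : Table n) where

  stepCost : (ℕ → ℚ) → Step n → ℚ
  stepCost next s = fromℕℚ (evaluations s) ℚ.+ sumℚ (map (next ∘ ∣_∣ ∘ proj₁) (calls s))

  -- Unfolds to the local cost function of `expectedAt`, which has no name outside that definition.
  pairCost : Fin n → (ℕ → ℚ) → Subset n × Subset n → ℚ
  pairCost i next (S , S′) = stepCost next (call σ i S S′)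

  branchCost : Fin n → (ℕ → ℚ) → ℕ → ℚ
  branchCost i next ℓ = fromℕℚ (c σ i ℕ.* ℓ) ℚ.+ fromℕℚ (suc (c σ i)) ℚ.* next ℓ

  pairCost-nonElement : ∀ i next {ℓ S S′} → ℓ ≢ 0 → ℓ ≢ n ℕ.∸ toℕ i → ∣ S ∣ ≡ ℓ → i ∉ S →
    Avoids i ℓ (J σ i) S′ → pairCost i next (S , S′) ≡ branchCost i next ℓ
  pairCost-nonElement i next {ℓ} {S} {S′} ℓ≢0 ℓ≢n∸i ≡.refl i∉S (i∉S′ , disjoint) =
    ≡.trans (≡.cong (stepCost next) call≡) (≡.cong₂ ℚ._+_
    (≡.cong (λ c → fromℕℚ (c ℕ.* ∣ S ∣)) (length-elements (J σ i))) (begin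
      next ∣ S ∣ ℚ.+ sumℚ (map (next ∘ ∣_∣ ∘ proj₁) (map (λ j → S , image (σ i j) S′) (elements (J σ i))))
        ≡⟨ ≡.cong (λ xs → next ∣ S ∣ ℚ.+ sumℚ xs) (List.map-∘ (elements (J σ i))) ⟨
      -- A call is charged by its first set, which is S in all of them; the extra list entry `i`
      -- stands for the call without a switch.
      sumℚ (map (λ _ → next ∣ S ∣) (i ∷ elements (J σ i)))
        ≡⟨ sumℚ-constant (λ _ → ≡.refl) (i ∷ elements (J σ i)) ⟩
      fromℕℚ (suc (length (elements (J σ i)))) ℚ.* next ∣ S ∣
        ≡⟨ ≡.cong (λ c → fromℕℚ (suc c) ℚ.* next ∣ S ∣) (length-elements (J σ i)) ⟩
      fromℕℚ (suc (c σ i)) ℚ.* next ∣ S ∣ ∎))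
    where
    open ≡.≡-Reasoning

    if-false : ∀ {a} {A : Set a} {b} {x y : A} → b ≡ false → (if b then x else y) ≡ y
    if-false ≡.refl = ≡.refl

    js : List (Fin n)
    js = elements (J σ i)

    call≡ : call σ i S S′ ≡
            step (length js ℕ.* ∣ S ∣) ((S , S′) ∷ map (λ j → S , image (σ i j) S′) js)
    call≡ = begin
      call σ i S S′
        ≡⟨ if-false (≡.cong₂ _∨_ (dec-false (∣ S ∣ ℕ.≟ 0) ℓ≢0)
             (dec-false (∣ S ∣ ℕ.≟ n ℕ.∸ toℕ i) ℓ≢n∸i)) ⟩
      (if does (i ∈? S) then elementBranch σ i S S′ else nonElementBranch σ i S S′)
        ≡⟨ if-false (dec-false (i ∈? S) i∉S) ⟩
      nonElementBranch σ i S S′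
        ≡⟨ if-false (≡.cong₂ _∨_ (dec-false (i ∈? S′) i∉S′)
             (dec-false (nonempty? (J σ i ∩ S′)) disjoint)) ⟩
      step (length js ℕ.* ∣ S ∣) ((S , S′) ∷ map (λ j → S , image (σ i j) S′) js) ∎

  pairCost-nonNeg : ∀ i {next} → (∀ ℓ → 0ℚ ℚ.≤ next ℓ) → ∀ SS′ → 0ℚ ℚ.≤ pairCost i next SS′
  pairCost-nonNeg i 0≤next (S , S′) =
    +-nonNeg (0≤fromℕℚ (evaluations (call σ i S S′)))
      (sumℚ-nonNeg (λ SS′ → 0≤next ∣ proj₁ SS′ ∣) (calls (call σ i S S′)))

  expectedAt-nonNeg : ∀ i {next} → (∀ ℓ → 0ℚ ℚ.≤ next ℓ) → ∀ ℓ → 0ℚ ℚ.≤ expectedAt σ i next ℓ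
  expectedAt-nonNeg i 0≤next ℓ =
    mean-nonNeg (pairCost-nonNeg i 0≤next) (cartesianProduct (subsetsFrom i ℓ) (subsetsFrom i ℓ))

  module _ (i : Fin n) (ℓ : ℕ) where

    private
      Ss : List (Subset n)
      Ss = subsetsFrom i ℓ

    samples omitting avoiding : ℕ
    samples  = length Ss
    omitting = count (λ S → ¬? (i ∈? S)) Ss
    avoiding = count (avoids? i ℓ (J σ i)) Ss

    -- The bound "probability times cost" multiplied by the number of sampled pairs. All other pairs
    -- cost at least 0 and are dropped.
    expectedAt-lowerBound : ∀ {next} → (∀ ℓ → 0ℚ ℚ.≤ next ℓ) → ℓ ≢ 0 → ℓ ≢ n ℕ.∸ toℕ i →
      fromℕℚ (omitting ℕ.* avoiding) ℚ.* branchCost i next ℓ ℚ.≤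
      fromℕℚ (samples ℕ.* samples) ℚ.* expectedAt σ i next ℓ
    expectedAt-lowerBound {next} 0≤next ℓ≢0 ℓ≢n∸i = begin
      fromℕℚ (omitting ℕ.* avoiding) ℚ.* v
        ≡⟨ ≡.cong (ℚ._* v) (fromℕℚ-homo-* omitting avoiding) ⟩
      fromℕℚ omitting ℚ.* fromℕℚ avoiding ℚ.* v
        ≡⟨ ℚ.*-assoc (fromℕℚ omitting) (fromℕℚ avoiding) v ⟩
      fromℕℚ omitting ℚ.* (fromℕℚ avoiding ℚ.* v)
        ≤⟨ count*≤sum (λ S → ¬? (i ∈? S))
             (λ S → sumℚ-nonNeg (λ S′ → cost-nonNeg (S , S′)) Ss) Ss (λ S S∈ i∉S →
             count*≤sum (avoids? i ℓ (J σ i)) (λ S′ → cost-nonNeg (S , S′)) Ss λ S′ _ avoids →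
               ℚ.≤-reflexive (≡.sym (pairCost-nonElement i next ℓ≢0 ℓ≢n∸i (size S∈) i∉S avoids))) ⟩
      sumℚ (map (λ S → sumℚ (map (λ S′ → pairCost i next (S , S′)) Ss)) Ss)
        ≡⟨ sumℚ-cartesianProduct (pairCost i next) Ss Ss ⟨
      sumℚ (map (pairCost i next) (cartesianProduct Ss Ss))
        ≡⟨ length*mean≡sum (map (pairCost i next) (cartesianProduct Ss Ss)) ⟨
      fromℕℚ (length (map (pairCost i next) (cartesianProduct Ss Ss))) ℚ.* expectedAt σ i next ℓ
        ≡⟨ ≡.cong (λ l → fromℕℚ l ℚ.* expectedAt σ i next ℓ)
             (≡.trans (List.length-map (pairCost i next) (cartesianProduct Ss Ss))
               (length-cartesianProductWith _,_ Ss Ss)) ⟩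
      fromℕℚ (samples ℕ.* samples) ℚ.* expectedAt σ i next ℓ ∎
      where
      open ℚ.≤-Reasoning
      v = branchCost i next ℓ

      cost-nonNeg : ∀ SS′ → 0ℚ ℚ.≤ pairCost i next SS′
      cost-nonNeg = pairCost-nonNeg i 0≤next

      size : ∀ {S} → S ∈ₗ Ss → ∣ S ∣ ≡ ℓ
      size S∈ = proj₂ (proj₂ (∈-filter⁻
        (λ S → Lift? (i Fin.≤?_) S ×-dec (∣ S ∣ ℕ.≟ ℓ)) {xs = allSubsets n} S∈))

-- Ordered fields

module OrderedFieldProperties {c₁ ℓ₁ ℓ₂} (K : OrderedField c₁ ℓ₁ ℓ₂) where
  open OrderedField K
  open CommutativeRing commutativeRing using (commutativeSemiring; +-monoid)
  open IsStrictPartialOrder isStrictPartialOrder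
    using (irrefl; asym; <-respˡ-≈; <-respʳ-≈) renaming (trans to <-trans)
  open MonoidMult +-monoid using (×-homo-+)
  open SemiringMult semiring using (×1-homo-*)
  open HeytingProperties heytingCommutativeRing using (x-0≈x)
  open SemiringSolver commutativeSemiring using (solve; _:+_; _:*_; _:=_)

  ≤-reflexive : ∀ {x y} → x ≈ₖ y → x ≤ y
  ≤-reflexive x≈y y<x = irrefl (sym x≈y) y<x

  -- Since `≤` is a negation, a supposed z < x has to be refuted. Cotransitivity of apartness places
  -- y apart from z or from x, and each of the resulting orders contradicts a hypothesis.
  ≤-trans : ∀ {x y z} → x ≤ y → y ≤ z → x ≤ z
  ≤-trans {y = y} x≤y y≤z z<x with #-cotrans (<⇒# z<x) y
  ... | inj₁ z#y with #⇒<∨> z#y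
  ...   | inj₁ z<y = y≤z z<y
  ...   | inj₂ y<z = x≤y (<-trans y<z z<x)
  ≤-trans {y = y} x≤y y≤z z<x | inj₂ y#x with #⇒<∨> y#x
  ...   | inj₁ y<x = x≤y y<x
  ...   | inj₂ x<y = y≤z (<-trans z<x x<y)

  <⇒≤ : ∀ {x y} → x < y → x ≤ y
  <⇒≤ = asym

  ≤-<-trans : ∀ {x y z} → x ≤ y → y < z → x < z
  ≤-<-trans {x} x≤y y<z with #-cotrans (<⇒# y<z) x
  ... | inj₁ y#x with #⇒<∨> y#x
  ...   | inj₁ y<x = contradiction y<x x≤y
  ...   | inj₂ x<y = <-trans x<y y<z
  ≤-<-trans {x} x≤y y<z | inj₂ x#z with #⇒<∨> x#z
  ...   | inj₁ x<z = x<z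
  ...   | inj₂ z<x = contradiction (<-trans y<z z<x) x≤y

  ≤-preorder : Preorder _ _ _
  ≤-preorder = record
    { isPreorder = record
      { isEquivalence = isEquivalence ; reflexive = ≤-reflexive ; trans = ≤-trans } }

  module ≤-Reasoning = PreorderReasoning ≤-preorder
  module ≈-Reasoning = SetoidReasoning setoid

  [x+y]-y≈x : ∀ x y → x + y - y ≈ₖ x
  [x+y]-y≈x x y = trans (+-assoc x y (- y)) (trans (+-congˡ (-‿inverseʳ y)) (+-identityʳ x))

  [x-y]+y≈x : ∀ x y → x - y + y ≈ₖ x
  [x-y]+y≈x x y = trans (+-assoc x (- y) y) (trans (+-congˡ (-‿inverseˡ y)) (+-identityʳ x))

  +-cancelʳ-≤ : ∀ z {x y} → x + z ≤ y + z → x ≤ y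
  +-cancelʳ-≤ z x+z≤y+z y<x = x+z≤y+z (+-monoˡ-< z y<x)

  +-monoˡ-≤ : ∀ z {x y} → x ≤ y → x + z ≤ y + z
  +-monoˡ-≤ z {x} {y} x≤y y+z<x+z = x≤y
    (<-respˡ-≈ ([x+y]-y≈x y z) (<-respʳ-≈ ([x+y]-y≈x x z) (+-monoˡ-< (- z) y+z<x+z)))

  +-monoʳ-≤ : ∀ z {x y} → x ≤ y → z + x ≤ z + y
  +-monoʳ-≤ z {x} {y} x≤y =
    ≤-trans (≤-reflexive (+-comm z x)) (≤-trans (+-monoˡ-≤ z x≤y) (≤-reflexive (+-comm y z)))

  x<y⇒0<y-x : ∀ {x y} → x < y → 0# < y - x
  x<y⇒0<y-x {x} x<y = <-respˡ-≈ (-‿inverseʳ x) (+-monoˡ-< (- x) x<y)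

  *-monoˡ-<-pos : ∀ {z x y} → 0# < z → x < y → x * z < y * z
  *-monoˡ-<-pos {z} {x} {y} 0<z x<y =
    <-respˡ-≈ (+-identityˡ (x * z))
      (<-respʳ-≈ (trans (sym (distribʳ z (y - x) x)) (*-congʳ ([x-y]+y≈x y x)))
        (+-monoˡ-< (x * z) (*-pos (x<y⇒0<y-x x<y) 0<z)))

  *-cancelʳ-≤-pos : ∀ {z x y} → 0# < z → x * z ≤ y * z → x ≤ y
  *-cancelʳ-≤-pos 0<z xz≤yz y<x = xz≤yz (*-monoˡ-<-pos 0<z y<x)

  -- The conclusion is a negation, so tightness of # allows a case distinction on x # y and z # 0.
  *-monoˡ-≤-nonNeg : ∀ {z x y} → 0# ≤ z → x ≤ y → x * z ≤ y * z
  *-monoˡ-≤-nonNeg {z} {x} {y} 0≤z x≤y yz<xz = z≉0 (proj₁ (tight z 0#) ¬z#0)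
    where
    z≉0 : ¬ z ≈ₖ 0#
    z≉0 z≈0 = irrefl
      (trans (*-congˡ z≈0) (trans (zeroʳ y) (sym (trans (*-congˡ z≈0) (zeroʳ x))))) yz<xz

    ¬x#y : 0# < z → ¬ x # y
    ¬x#y 0<z x#y with #⇒<∨> x#y
    ... | inj₁ x<y = asym yz<xz (*-monoˡ-<-pos 0<z x<y)
    ... | inj₂ y<x = x≤y y<x

    ¬z#0 : ¬ z # 0#
    ¬z#0 z#0 with #⇒<∨> z#0
    ... | inj₁ z<0 = 0≤z z<0
    ... | inj₂ 0<z = irrefl (*-congʳ (sym (proj₁ (tight x y) (¬x#y 0<z)))) yz<xz

  *-monoʳ-≤-nonNeg : ∀ {z x y} → 0# ≤ z → x ≤ y → z * x ≤ z * y
  *-monoʳ-≤-nonNeg {z} {x} {y} 0≤z x≤y =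
    ≤-trans (≤-reflexive (*-comm z x))
      (≤-trans (*-monoˡ-≤-nonNeg 0≤z x≤y) (≤-reflexive (*-comm y z)))

  ^-pos : ∀ {x} → 0# < x → ∀ k → 0# < x ^ k
  ^-pos 0<x zero    = 0<1
  ^-pos 0<x (suc k) = *-pos 0<x (^-pos 0<x k)

  -- Natural and rational numbers in the field

  fromℕ-homo-+ : ∀ a b → fromℕ (a ℕ.+ b) ≈ₖ fromℕ a + fromℕ b
  fromℕ-homo-+ = ×-homo-+ 1#

  fromℕ-homo-* : ∀ a b → fromℕ (a ℕ.* b) ≈ₖ fromℕ a * fromℕ b
  fromℕ-homo-* = ×1-homo-*

  fromℕ-cong : ∀ {a b} → a ≡ b → fromℕ a ≈ₖ fromℕ b
  fromℕ-cong ≡.refl = refl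

  fromℕ-1 : fromℕ 1 ≈ₖ 1#
  fromℕ-1 = +-identityʳ 1#

  0≤fromℕ : ∀ a → 0# ≤ fromℕ a
  0≤fromℕ zero    = ≤-reflexive refl
  0≤fromℕ (suc a) = <⇒≤ (0<fromℕ a)

  fromℕ-pos : ∀ {a} → 0 ℕ.< a → 0# < fromℕ a
  fromℕ-pos {suc a} _ = 0<fromℕ a

  fromℕ-mono-≤ : ∀ {a b} → a ℕ.≤ b → fromℕ a ≤ fromℕ b
  fromℕ-mono-≤ {a} {b} a≤b = begin
    fromℕ a                    ≈⟨ +-identityˡ (fromℕ a) ⟨
    0# + fromℕ a               ≲⟨ +-monoˡ-≤ (fromℕ a) (0≤fromℕ (b ℕ.∸ a)) ⟩
    fromℕ (b ℕ.∸ a) + fromℕ a  ≈⟨ fromℕ-homo-+ (b ℕ.∸ a) a ⟨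
    fromℕ (b ℕ.∸ a ℕ.+ a)      ≈⟨ fromℕ-cong (ℕ.m∸n+n≡m a≤b) ⟩
    fromℕ b                    ∎
    where open ≤-Reasoning

  fromℕ-cancel-< : ∀ {a b} → fromℕ a < fromℕ b → a ℕ.< b
  fromℕ-cancel-< fa<fb = ℕ.≰⇒> λ b≤a → fromℕ-mono-≤ b≤a fa<fb

  x*recip≈1 : ∀ {x} (0<x : 0# < x) → x * recip 0<x ≈ₖ 1#
  x*recip≈1 {x} 0<x with #⇒invertible (#-sym (<⇒# 0<x))
  ... | _ , _ , [x-0]*x⁻¹≈1 = trans (*-congʳ (sym (x-0≈x x))) [x-0]*x⁻¹≈1

  fromℚ*denominator : ∀ q {k} → ℚ.↥ q ≡ + k → fromℚ q * fromℕ (ℚ.↧ₙ q) ≈ₖ fromℕ k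
  fromℚ*denominator q {k} ↥q≡k = begin
    fromℤ (ℚ.↥ q) * r * d
      ≈⟨ *-assoc (fromℤ (ℚ.↥ q)) r d ⟩
    fromℤ (ℚ.↥ q) * (r * d)
      ≈⟨ *-cong (reflexive (≡.cong fromℤ ↥q≡k)) (trans (*-comm r d) (x*recip≈1 _)) ⟩
    fromℕ k * 1#
      ≈⟨ *-identityʳ (fromℕ k) ⟩
    fromℕ k ∎
    where
    open ≈-Reasoning
    d = fromℕ (ℚ.↧ₙ q)
    r = recip (0<fromℕ (ℚ.denominator-1 q))

  numerator-nonNeg : ∀ q → 0ℚ ℚ.≤ q → ∃ λ k → ℚ.↥ q ≡ + k
  numerator-nonNeg (mkℚ (+ k)    _ _) _        = k , ≡.refl
  numerator-nonNeg (mkℚ -[1+ k ] _ _) (*≤* ())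

  fromℚ-nonNeg : ∀ q → 0ℚ ℚ.≤ q → 0# ≤ fromℚ q
  fromℚ-nonNeg q 0≤q with numerator-nonNeg q 0≤q
  ... | k , ↥q≡k = *-cancelʳ-≤-pos (0<fromℕ (ℚ.denominator-1 q))
    (≤-trans (≤-reflexive (zeroˡ _))
      (≤-trans (0≤fromℕ k) (≤-reflexive (sym (fromℚ*denominator q ↥q≡k)))))

  -- The detour through unnormalised rationals keeps out the common factors that multiplication in ℚ
  -- cancels.
  cross-multiply : ∀ a b x y {p q} → ℚ.↥ x ≡ + p → ℚ.↥ y ≡ + q →
    fromℕℚ a ℚ.* x ℚ.≤ fromℕℚ b ℚ.* y → a ℕ.* p ℕ.* ℚ.↧ₙ y ℕ.≤ b ℕ.* q ℕ.* ℚ.↧ₙ x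
  cross-multiply a b x@(mkℚ (+ p) d _) y@(mkℚ (+ q) e _) ≡.refl ≡.refl ax≤by =
    ℤ.drop‿+≤+ (≡.subst₂ ℤ._≤_ (side a p (suc e)) (side b q (suc d)) (ℚᵘ.drop-*≤* unnormalised))
    where
    unnormalised : ℚᵘ.mkℚᵘ (+ a) 0 ℚᵘ.* toℚᵘ x ℚᵘ.≤ ℚᵘ.mkℚᵘ (+ b) 0 ℚᵘ.* toℚᵘ y
    unnormalised = begin
      ℚᵘ.mkℚᵘ (+ a) 0 ℚᵘ.* toℚᵘ x  ≃⟨ ℚᵘ.*-congʳ (toℚᵘ-fromℕℚ a) ⟨
      toℚᵘ (fromℕℚ a) ℚᵘ.* toℚᵘ x  ≃⟨ ℚ.toℚᵘ-homo-* (fromℕℚ a) x ⟨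
      toℚᵘ (fromℕℚ a ℚ.* x)        ≤⟨ ℚ.toℚᵘ-mono-≤ ax≤by ⟩
      toℚᵘ (fromℕℚ b ℚ.* y)        ≃⟨ ℚ.toℚᵘ-homo-* (fromℕℚ b) y ⟩
      toℚᵘ (fromℕℚ b) ℚᵘ.* toℚᵘ y  ≃⟨ ℚᵘ.*-congʳ (toℚᵘ-fromℕℚ b) ⟩
      ℚᵘ.mkℚᵘ (+ b) 0 ℚᵘ.* toℚᵘ y  ∎
      where open ℚᵘ.≤-Reasoning

    side : ∀ a p e → + a ℤ.* + p ℤ.* + (1 ℕ.* e) ≡ + (a ℕ.* p ℕ.* e)
    side a p e = ≡.trans
      (≡.cong₂ ℤ._*_ (≡.sym (ℤ.pos-* a p)) (≡.cong +_ (ℕ.*-identityˡ e)))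
      (≡.sym (ℤ.pos-* (a ℕ.* p) e))

  -- Multiplying by both denominators turns each side into the image of a natural number, where
  -- `cross-multiply` applies. The factors a and b carry the numbers of sampled pairs from ℚ into
  -- the field.
  fromℚ-mono : ∀ a b x y → 0ℚ ℚ.≤ x → 0ℚ ℚ.≤ y →
    fromℕℚ a ℚ.* x ℚ.≤ fromℕℚ b ℚ.* y → fromℕ a * fromℚ x ≤ fromℕ b * fromℚ y
  fromℚ-mono a b x y 0≤x 0≤y ax≤by with numerator-nonNeg x 0≤x | numerator-nonNeg y 0≤y
  ... | p , ↥x≡p | q , ↥y≡q =
    *-cancelʳ-≤-pos (*-pos (0<fromℕ (ℚ.denominator-1 x)) (0<fromℕ (ℚ.denominator-1 y))) (begin
      fromℕ a * X * (D * E)       ≈⟨ regroup (fromℕ a) X D E ⟩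
      fromℕ a * (X * D) * E       ≈⟨ *-congʳ (*-congˡ (fromℚ*denominator x ↥x≡p)) ⟩
      fromℕ a * fromℕ p * E       ≈⟨ homo a p (ℚ.↧ₙ y) ⟨
      fromℕ (a ℕ.* p ℕ.* ℚ.↧ₙ y)  ≲⟨ fromℕ-mono-≤ (cross-multiply a b x y ↥x≡p ↥y≡q ax≤by) ⟩
      fromℕ (b ℕ.* q ℕ.* ℚ.↧ₙ x)  ≈⟨ homo b q (ℚ.↧ₙ x) ⟩
      fromℕ b * fromℕ q * D       ≈⟨ *-congʳ (*-congˡ (fromℚ*denominator y ↥y≡q)) ⟨
      fromℕ b * (Y * E) * D       ≈⟨ regroup (fromℕ b) Y E D ⟨
      fromℕ b * Y * (E * D)       ≈⟨ *-congˡ (*-comm E D) ⟩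
      fromℕ b * Y * (D * E)       ∎)
    where
    open ≤-Reasoning
    X = fromℚ x
    Y = fromℚ y
    D = fromℕ (ℚ.↧ₙ x)
    E = fromℕ (ℚ.↧ₙ y)

    regroup : ∀ u v w z → u * v * (w * z) ≈ₖ u * (v * w) * z
    regroup = solve 4 (λ u v w z → u :* v :* (w :* z) := u :* (v :* w) :* z) refl

    homo : ∀ a p e → fromℕ (a ℕ.* p ℕ.* e) ≈ₖ fromℕ a * fromℕ p * fromℕ e
    homo a p e = trans (fromℕ-homo-* (a ℕ.* p) e) (*-congʳ (fromℕ-homo-* a p))

  fromℚ-mono-scaled : ∀ a x y → 0ℚ ℚ.≤ x → 0ℚ ℚ.≤ y →
    fromℕℚ a ℚ.* x ℚ.≤ y → fromℕ a * fromℚ x ≤ fromℚ y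
  fromℚ-mono-scaled a x y 0≤x 0≤y ax≤y = begin
    fromℕ a * fromℚ x
      ≲⟨ fromℚ-mono a 1 x y 0≤x 0≤y (ℚ.≤-trans ax≤y (ℚ.≤-reflexive (≡.sym (ℚ.*-identityˡ y)))) ⟩
    fromℕ 1 * fromℚ y
      ≈⟨ *-congʳ fromℕ-1 ⟩
    1# * fromℚ y
      ≈⟨ *-identityˡ (fromℚ y) ⟩
    fromℚ y ∎
    where open ≤-Reasoning

  -- Lower bounds for ratios of binomial coefficients

  module _ {t μ : 𝕂} (t+μ≈1 : t + μ ≈ₖ 1#) (0<t : 0# < t) (0<μ : 0# < μ) where

    -- As t a is a - μ a, taking away at most μ a leaves at least t a. Adding μ a to both sides
    -- replaces the subtraction.
    scale-fromℕ-≤ : ∀ {a} b d → a ℕ.≤ b ℕ.+ d → fromℕ d ≤ μ * fromℕ a → t * fromℕ a ≤ fromℕ b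
    scale-fromℕ-≤ {a} b d a≤b+d d≤μa = +-cancelʳ-≤ (μ * fromℕ a) (begin
      t * fromℕ a + μ * fromℕ a  ≈⟨ distribʳ (fromℕ a) t μ ⟨
      (t + μ) * fromℕ a          ≈⟨ *-congʳ t+μ≈1 ⟩
      1# * fromℕ a               ≈⟨ *-identityˡ (fromℕ a) ⟩
      fromℕ a                    ≲⟨ fromℕ-mono-≤ a≤b+d ⟩
      fromℕ (b ℕ.+ d)            ≈⟨ fromℕ-homo-+ b d ⟩
      fromℕ b + fromℕ d          ≲⟨ +-monoʳ-≤ (fromℕ b) d≤μa ⟩
      fromℕ b + μ * fromℕ a      ∎)
      where open ≤-Reasoning

    -- C(u, k) / C(N, k) is the product of the ratios (u - j) / (N - j) for j < k, each at least t.
    -- The induction splits off the last ratio by the absorption identity, used for both N and u,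
    -- and cancels k + 1.
    ^*nCk≤uCk : ∀ {N u} k → (∀ j → j ℕ.< k → t * fromℕ (N ℕ.∸ j) ≤ fromℕ (u ℕ.∸ j)) →
                t ^ k * fromℕ (N C k) ≤ fromℕ (u C k)
    ^*nCk≤uCk {N} {u} zero    _    = ≤-reflexive (*-identityˡ (fromℕ 1))
    ^*nCk≤uCk {N} {u} (suc k) factors≤ = *-cancelʳ-≤-pos (0<fromℕ k) (begin
      t ^ suc k * fromℕ (N C suc k) * fromℕ (suc k)
        ≈⟨ pull t (t ^ k) (fromℕ (N C suc k)) (fromℕ (suc k)) ⟩
      t * t ^ k * (fromℕ (suc k) * fromℕ (N C suc k))
        ≈⟨ *-congˡ (absorb N) ⟩
      t * t ^ k * (fromℕ (N ℕ.∸ k) * fromℕ (N C k))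
        ≈⟨ exchange t (t ^ k) (fromℕ (N ℕ.∸ k)) (fromℕ (N C k)) ⟩
      (t * fromℕ (N ℕ.∸ k)) * (t ^ k * fromℕ (N C k))
        ≲⟨ *-monoˡ-≤-nonNeg (nonNeg (<⇒≤ (^-pos 0<t k)) (0≤fromℕ (N C k))) (factors≤ k ℕ.≤-refl) ⟩
      fromℕ (u ℕ.∸ k) * (t ^ k * fromℕ (N C k))
        ≲⟨ *-monoʳ-≤-nonNeg (0≤fromℕ (u ℕ.∸ k))
             (^*nCk≤uCk k (λ j j<k → factors≤ j (ℕ.m≤n⇒m≤1+n j<k))) ⟩
      fromℕ (u ℕ.∸ k) * fromℕ (u C k)
        ≈⟨ absorb u ⟨
      fromℕ (suc k) * fromℕ (u C suc k)
        ≈⟨ *-comm _ _ ⟩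
      fromℕ (u C suc k) * fromℕ (suc k) ∎)
      where
      open ≤-Reasoning
      absorb : ∀ n → fromℕ (suc k) * fromℕ (n C suc k) ≈ₖ fromℕ (n ℕ.∸ k) * fromℕ (n C k)
      absorb n = trans (sym (fromℕ-homo-* (suc k) (n C suc k)))
        (trans (fromℕ-cong ([k+1]*nC[k+1]≡[n∸k]*nCk n k)) (fromℕ-homo-* (n ℕ.∸ k) (n C k)))

      nonNeg : ∀ {x y} → 0# ≤ x → 0# ≤ y → 0# ≤ x * y
      nonNeg {x} {y} 0≤x 0≤y = ≤-trans (≤-reflexive (sym (zeroˡ y))) (*-monoˡ-≤-nonNeg 0≤y 0≤x)

      pull : ∀ a b x s → a * b * x * s ≈ₖ a * b * (s * x)
      pull = solve 4 (λ a b x s → a :* b :* x :* s := a :* b :* (s :* x)) refl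

      exchange : ∀ a b x y → a * b * (x * y) ≈ₖ (a * x) * (b * y)
      exchange = solve 4 (λ a b x y → a :* b :* (x :* y) := (a :* x) :* (b :* y)) refl

    -- The ratio is (N - k) / N with N = n + 1, that is 1 - k / N, and k ≤ μ N.
    t*[n+1]Ck≤nCk : ∀ {n k} → k ℕ.≤ suc n → fromℕ k ≤ μ * fromℕ (suc n) →
                    t * fromℕ (suc n C k) ≤ fromℕ (n C k)
    t*[n+1]Ck≤nCk {n} {k} k≤1+n k≤μ[1+n] = *-cancelʳ-≤-pos (0<fromℕ n) (begin
      t * fromℕ (suc n C k) * fromℕ (suc n)  ≈⟨ exchange t (fromℕ (suc n C k)) (fromℕ (suc n)) ⟩
      t * fromℕ (suc n) * fromℕ (suc n C k)
        ≲⟨ *-monoˡ-≤-nonNeg (0≤fromℕ (suc n C k))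
             (scale-fromℕ-≤ (suc n ℕ.∸ k) k (ℕ.≤-reflexive (≡.sym (ℕ.m∸n+n≡m k≤1+n))) k≤μ[1+n]) ⟩
      fromℕ (suc n ℕ.∸ k) * fromℕ (suc n C k)  ≈⟨ fromℕ-homo-* (suc n ℕ.∸ k) (suc n C k) ⟨
      fromℕ ((suc n ℕ.∸ k) ℕ.* (suc n C k))    ≈⟨ fromℕ-cong ([n+1]*nCk≡[n+1∸k]*[n+1]Ck n k) ⟨
      fromℕ (suc n ℕ.* (n C k))                ≈⟨ fromℕ-homo-* (suc n) (n C k) ⟩
      fromℕ (suc n) * fromℕ (n C k)            ≈⟨ *-comm _ _ ⟩
      fromℕ (n C k) * fromℕ (suc n)            ∎)
      where
      open ≤-Reasoning
      exchange : ∀ a b c → a * b * c ≈ₖ a * c * b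
      exchange = solve 3 (λ a b c → a :* b :* c := a :* c :* b) refl

    -- Each ratio is at least 1 - d / (N - j). For j < k the denominator is at least N - k + 1, so
    -- the one hypothesis on d controls all k ratios.
    t^k*NCk≤uCk : ∀ {N u d k} → N ℕ.≤ u ℕ.+ d → fromℕ d ≤ μ * fromℕ (suc (N ℕ.∸ k)) →
                  t ^ k * fromℕ (N C k) ≤ fromℕ (u C k)
    t^k*NCk≤uCk {N} {u} {d} {k} N≤u+d d≤ with ℕ.≤-<-connex k N
    -- Here C(N, k) = 0 and the claim is trivial.
    ... | inj₂ N<k = ≤-trans (≤-reflexive
          (trans (*-congˡ (fromℕ-cong (k>n⇒nCk≡0 N<k))) (zeroʳ (t ^ k)))) (0≤fromℕ (u C k))
    ... | inj₁ k≤N = ^*nCk≤uCk k λ j j<k → scale-fromℕ-≤ (u ℕ.∸ j) d (N∸j≤ j)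
      (≤-trans d≤ (*-monoʳ-≤-nonNeg (<⇒≤ 0<μ) (fromℕ-mono-≤ (ℕ.∸-monoʳ-< j<k k≤N))))
      where
      N∸j≤ : ∀ j → N ℕ.∸ j ℕ.≤ (u ℕ.∸ j) ℕ.+ d
      N∸j≤ j = ℕ.≤-trans (ℕ.∸-monoˡ-≤ j N≤u+d) (ℕ.m≤n+o⇒m∸n≤o (u ℕ.+ d) j
        (ℕ.≤-trans (ℕ.+-monoˡ-≤ d (ℕ.m≤n+m∸n u j)) (ℕ.≤-reflexive (ℕ.+-assoc j (u ℕ.∸ j) d))))

-- The estimate

take-tabulate⁺ : ∀ {a p} {A : Set a} {P : A → Set p} {m} (f : Fin m → A) s →
                 (∀ j → toℕ j ℕ.< s → P (f j)) → All P (take s (tabulate f))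
take-tabulate⁺           f zero    Pf = []
take-tabulate⁺ {m = zero}  f (suc s) Pf = []
take-tabulate⁺ {m = suc m} f (suc s) Pf =
  Pf Fin.zero (s≤s z≤n) ∷ take-tabulate⁺ (f ∘ Fin.suc) s (λ j j<s → Pf (Fin.suc j) (s≤s j<s))

nonempty⇒0<∣p∣ : ∀ {n} (p : Subset n) → Nonempty p → 0 ℕ.< ∣ p ∣
nonempty⇒0<∣p∣ p (x , x∈p) = ≡.subst (ℕ._≤ ∣ p ∣) (Subset.∣⁅x⁆∣≡1 x)
  (Subset.p⊆q⇒∣p∣≤∣q∣ λ y∈ → ≡.subst (_∈ p) (≡.sym (Subset.x∈⁅y⁆⇒x≡y x y∈)) x∈p)

module _ {n} (σ : Table n) where

  branchCost-nonNeg : ∀ i {next} → (∀ ℓ → 0ℚ ℚ.≤ next ℓ) → ∀ ℓ → 0ℚ ℚ.≤ branchCost σ i next ℓ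
  branchCost-nonNeg i 0≤next ℓ =
    +-nonNeg (0≤fromℕℚ (c σ i ℕ.* ℓ)) (*-nonNeg (0≤fromℕℚ (suc (c σ i))) (0≤next ℓ))

  calls≤branchCost : ∀ i next ℓ → fromℕℚ (suc (c σ i)) ℚ.* next ℓ ℚ.≤ branchCost σ i next ℓ
  calls≤branchCost i next ℓ = ℚ.≤-trans (ℚ.≤-reflexive (≡.sym (ℚ.+-identityˡ _)))
    (ℚ.+-monoˡ-≤ (fromℕℚ (suc (c σ i)) ℚ.* next ℓ) (0≤fromℕℚ (c σ i ℕ.* ℓ)))

  -- 2c + 1 ≥ 3/2 (c + 1) because c ≥ 1 in an effective row.
  lastBranchCost : ∀ i ℓ → Effective σ i →
    fromℕℚ (suc (c σ i) ℕ.* ℓ) ℚ.* (+ 3 / 2) ℚ.≤ branchCost σ i fromℕℚ ℓ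
  lastBranchCost i ℓ effective = ℚ.*-cancelʳ-≤-pos (fromℕℚ 2) (begin
    fromℕℚ a ℚ.* (+ 3 / 2) ℚ.* fromℕℚ 2
      ≡⟨ ℚ.*-assoc (fromℕℚ a) (+ 3 / 2) (fromℕℚ 2) ⟩
    fromℕℚ a ℚ.* fromℕℚ 3
      ≡⟨ fromℕℚ-homo-* a 3 ⟨
    fromℕℚ (a ℕ.* 3)
      ≤⟨ fromℕℚ-mono-≤ (bound (c σ i) (nonempty⇒0<∣p∣ (J σ i) effective)) ⟩
    fromℕℚ ((c σ i ℕ.* ℓ ℕ.+ a) ℕ.* 2)
      ≡⟨ fromℕℚ-homo-* (c σ i ℕ.* ℓ ℕ.+ a) 2 ⟩
    fromℕℚ (c σ i ℕ.* ℓ ℕ.+ a) ℚ.* fromℕℚ 2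
      ≡⟨ ≡.cong (ℚ._* fromℕℚ 2) (≡.trans (fromℕℚ-homo-+ (c σ i ℕ.* ℓ) a)
           (≡.cong (fromℕℚ (c σ i ℕ.* ℓ) ℚ.+_) (fromℕℚ-homo-* (suc (c σ i)) ℓ))) ⟩
    branchCost σ i fromℕℚ ℓ ℚ.* fromℕℚ 2 ∎)
    where
    open ℚ.≤-Reasoning
    a = suc (c σ i) ℕ.* ℓ

    bound : ∀ d → 0 ℕ.< d → suc d ℕ.* ℓ ℕ.* 3 ℕ.≤ (d ℕ.* ℓ ℕ.+ suc d ℕ.* ℓ) ℕ.* 2
    bound (suc e) _ = ≡.subst (suc (suc e) ℕ.* ℓ ℕ.* 3 ℕ.≤_)
      (≡.sym (excess e ℓ)) (ℕ.m≤m+n _ (e ℕ.* ℓ))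
      where
      excess : ∀ e ℓ → (suc e ℕ.* ℓ ℕ.+ suc (suc e) ℕ.* ℓ) ℕ.* 2 ≡
                       suc (suc e) ℕ.* ℓ ℕ.* 3 ℕ.+ e ℕ.* ℓ
      excess = solve-∀

  -- The base of the recursion is row r instead of the comparison at level r + 1, because row r is
  -- where the factor 3/2 arises.
  E-from : Fin n → List (Fin n) → ℕ → ℚ
  E-from r is = foldr (expectedAt σ) (expectedAt σ r fromℕℚ) is

  E-from-nonNeg : ∀ r is ℓ → 0ℚ ℚ.≤ E-from r is ℓ
  E-from-nonNeg r []       = expectedAt-nonNeg σ r 0≤fromℕℚ
  E-from-nonNeg r (i ∷ is) = expectedAt-nonNeg σ i (E-from-nonNeg r is)

  E-mst≡E-from : ∀ r → E-mst σ r ≡ E-from r (take (toℕ r) (allFin n))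
  E-mst≡E-from r = ≡.trans
    (≡.cong (foldr (expectedAt σ) fromℕℚ) (List.take-suc-tabulate id r))
    (List.foldr-∷ʳ (expectedAt σ) fromℕℚ r (take (toℕ r) (allFin n)))

module Estimate {c₁ ℓ₁ ℓ₂} (K : OrderedField c₁ ℓ₁ ℓ₂) {t μ : OrderedField.𝕂 K} where
  open OrderedField K
  open OrderedFieldProperties K
  open CommutativeRing commutativeRing using (commutativeSemiring)
  open SemiringExp semiring using (^-homo-*; ^-congʳ)
  open SemiringSolver commutativeSemiring using (solve; _:+_; _:*_; _:=_)

  module _ (t+μ≈1 : t + μ ≈ₖ 1#) (0<t : 0# < t) (0<μ : 0# < μ)
           {n} (σ : Table n) (m : ℕ) (m≢0 : m ≢ 0) where

    -- The two hypotheses of the theorem for one row, without subtraction in the field: n ∸ toℕ i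
    -- points lie at or above i.
    record Sparse (i : Fin n) : Set ℓ₂ where
      field
        m<n∸i : m ℕ.< n ℕ.∸ toℕ i
        m≤    : fromℕ m ≤ μ * fromℕ (n ℕ.∸ toℕ i)
        1+c≤  : fromℕ (suc (c σ i)) ≤ μ * fromℕ (suc (n ℕ.∸ toℕ i ℕ.∸ m))

    module _ {i : Fin n} (sparse : Sparse i) where
      open Sparse sparse

      omitting≥ : t * fromℕ (samples σ i m) ≤ fromℕ (omitting σ i m)
      omitting≥ = begin
        t * fromℕ (samples σ i m)
          ≈⟨ *-congˡ (fromℕ-cong (≡.trans (length-subsetsFrom i m) (≡.cong (_C m) N≡1+w))) ⟩
        t * fromℕ (suc (n ℕ.∸ suc (toℕ i)) C m)
          ≲⟨ t*[n+1]Ck≤nCk t+μ≈1 0<t 0<μ {n ℕ.∸ suc (toℕ i)} (≡.subst (m ℕ.≤_) N≡1+w (ℕ.<⇒≤ m<n∸i))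
               (≤-trans m≤ (≤-reflexive (*-congˡ (fromℕ-cong N≡1+w)))) ⟩
        fromℕ ((n ℕ.∸ suc (toℕ i)) C m)  ≈⟨ fromℕ-cong (count-∌ i m) ⟨
        fromℕ (omitting σ i m)           ∎
        where
        open ≤-Reasoning
        N≡1+w : n ℕ.∸ toℕ i ≡ suc (n ℕ.∸ suc (toℕ i))
        N≡1+w = ℕ.+-∸-assoc 1 (Fin.toℕ<n i)

      avoiding≥ : t ^ m * fromℕ (samples σ i m) ≤ fromℕ (avoiding σ i m)
      avoiding≥ = begin
        t ^ m * fromℕ (samples σ i m)  ≈⟨ *-congˡ (fromℕ-cong (length-subsetsFrom i m)) ⟩
        t ^ m * fromℕ ((n ℕ.∸ toℕ i) C m)
          ≲⟨ t^k*NCk≤uCk t+μ≈1 0<t 0<μ {u = ∣ above n (suc (toℕ i)) ─ J σ i ∣} {k = m}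
               (n∸i≤avoiding+∣V∣ i m (J σ i)) 1+c≤ ⟩
        fromℕ (∣ above n (suc (toℕ i)) ─ J σ i ∣ C m)  ≈⟨ fromℕ-cong (count-avoiding i m (J σ i)) ⟨
        fromℕ (avoiding σ i m)                         ∎
        where open ≤-Reasoning

      -- Both sides are multiplied by the square of the number T of samples. One T meets the bound
      -- for omitting i, the other the bound for avoiding i and J(i), and together they spend the m
      -- + 1 factors t.
      expectedAt≥ : ∀ {next} → (∀ ℓ → 0ℚ ℚ.≤ next ℓ) →
        t ^ suc m * fromℚ (branchCost σ i next m) ≤ fromℚ (expectedAt σ i next m)
      expectedAt≥ {next} 0≤next = *-cancelʳ-≤-pos (*-pos 0<T 0<T) (begin
        t ^ suc m * Z * (T * T)  ≈⟨ regroup t (t ^ m) Z T ⟩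
        t * T * (t ^ m * T) * Z  ≲⟨ *-monoˡ-≤-nonNeg 0≤Z (≤-trans
            (*-monoʳ-≤-nonNeg (<⇒≤ (*-pos 0<t 0<T)) avoiding≥)
            (*-monoˡ-≤-nonNeg (0≤fromℕ (avoiding σ i m)) omitting≥)) ⟩
        fromℕ (omitting σ i m) * fromℕ (avoiding σ i m) * Z
          ≈⟨ *-congʳ (fromℕ-homo-* (omitting σ i m) (avoiding σ i m)) ⟨
        fromℕ (omitting σ i m ℕ.* avoiding σ i m) * Z
          ≲⟨ fromℚ-mono (omitting σ i m ℕ.* avoiding σ i m) (samples σ i m ℕ.* samples σ i m) z e
               (branchCost-nonNeg σ i 0≤next m) (expectedAt-nonNeg σ i 0≤next m)
               (expectedAt-lowerBound σ i m 0≤next m≢0 (ℕ.<⇒≢ m<n∸i)) ⟩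
        fromℕ (samples σ i m ℕ.* samples σ i m) * fromℚ e
          ≈⟨ *-congʳ (fromℕ-homo-* (samples σ i m) (samples σ i m)) ⟩
        T * T * fromℚ e
          ≈⟨ *-comm (T * T) (fromℚ e) ⟩
        fromℚ e * (T * T) ∎)
        where
        open ≤-Reasoning
        z = branchCost σ i next m
        e = expectedAt σ i next m
        Z = fromℚ z
        T = fromℕ (samples σ i m)

        0<T : 0# < T
        0<T = fromℕ-pos (≡.subst (0 ℕ.<_) (≡.sym (length-subsetsFrom i m)) (0<nCk (ℕ.<⇒≤ m<n∸i)))

        0≤Z : 0# ≤ Z
        0≤Z = fromℚ-nonNeg z (branchCost-nonNeg σ i 0≤next m)

        regroup : ∀ a b x y → a * b * x * (y * y) ≈ₖ a * y * (b * y) * x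
        regroup = solve 4 (λ a b x y → a :* b :* x :* (y :* y) := a :* y :* (b :* y) :* x) refl

    module _ {r : Fin n} (r-effective : Effective σ r) (r-sparse : Sparse r) where

      -- Each row contributes a factor c + 1 for its calls and t to the power m + 1 for the
      -- probability; row r alone supplies 3/2 and m.
      E-from≥ : ∀ is → All Sparse is →
        fromℚ (+ 3 / 2) * t ^ (suc (length is) ℕ.* suc m) *
          fromℕ (product (map (suc ∘ c σ) is) ℕ.* (suc (c σ r) ℕ.* m))
        ≤ fromℚ (E-from σ r is m)
      E-from≥ [] [] = begin
        q * t ^ (suc m ℕ.+ 0) * fromℕ (1 ℕ.* a)
          ≈⟨ *-cong (*-congˡ (^-congʳ t (ℕ.+-identityʳ (suc m)))) (fromℕ-cong (ℕ.*-identityˡ a)) ⟩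
        q * t ^ suc m * fromℕ a
          ≈⟨ rotate q (t ^ suc m) (fromℕ a) ⟩
        t ^ suc m * (fromℕ a * q)
          ≲⟨ *-monoʳ-≤-nonNeg (<⇒≤ (^-pos 0<t (suc m)))
            (fromℚ-mono-scaled a (+ 3 / 2) (branchCost σ r fromℕℚ m)
              (ℚ.nonNegative⁻¹ (+ 3 / 2)) (branchCost-nonNeg σ r 0≤fromℕℚ m)
              (lastBranchCost σ r m r-effective)) ⟩
        t ^ suc m * fromℚ (branchCost σ r fromℕℚ m)
          ≲⟨ expectedAt≥ r-sparse 0≤fromℕℚ ⟩
        fromℚ (expectedAt σ r fromℕℚ m) ∎
        where
        open ≤-Reasoning
        a = suc (c σ r) ℕ.* m
        q = fromℚ (+ 3 / 2)
        rotate : ∀ x y z → x * y * z ≈ₖ y * (z * x)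
        rotate = solve 3 (λ x y z → x :* y :* z := y :* (z :* x)) refl
      E-from≥ (i ∷ is) (i-sparse ∷ is-sparse) = begin
        q * t ^ (suc m ℕ.+ e) * fromℕ (suc (c σ i) ℕ.* p ℕ.* a)
          ≈⟨ *-cong (*-congˡ (^-homo-* t (suc m) e))
               (trans (fromℕ-cong (ℕ.*-assoc (suc (c σ i)) p a))
                 (fromℕ-homo-* (suc (c σ i)) (p ℕ.* a))) ⟩
        q * (t ^ suc m * t ^ e) * (fromℕ (suc (c σ i)) * fromℕ (p ℕ.* a))
          ≈⟨ regroup q (t ^ suc m) (t ^ e) (fromℕ (suc (c σ i))) (fromℕ (p ℕ.* a)) ⟩
        t ^ suc m * (fromℕ (suc (c σ i)) * (q * t ^ e * fromℕ (p ℕ.* a)))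
          ≲⟨ *-monoʳ-≤-nonNeg 0≤t^1+m
               (*-monoʳ-≤-nonNeg (0≤fromℕ (suc (c σ i))) (E-from≥ is is-sparse)) ⟩
        t ^ suc m * (fromℕ (suc (c σ i)) * fromℚ (next m))
          ≲⟨ *-monoʳ-≤-nonNeg 0≤t^1+m
               -- In rows before r only the recursive calls are kept; the evaluations made in the
               -- row itself are given up.
               (fromℚ-mono-scaled (suc (c σ i)) (next m) (branchCost σ i next m)
               (E-from-nonNeg σ r is m) (branchCost-nonNeg σ i (E-from-nonNeg σ r is) m)
               (calls≤branchCost σ i next m)) ⟩
        t ^ suc m * fromℚ (branchCost σ i next m)
          ≲⟨ expectedAt≥ i-sparse (E-from-nonNeg σ r is) ⟩
        fromℚ (expectedAt σ i next m) ∎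
        where
        open ≤-Reasoning
        next = E-from σ r is
        q = fromℚ (+ 3 / 2)
        e = suc (length is) ℕ.* suc m
        p = product (map (suc ∘ c σ) is)
        a = suc (c σ r) ℕ.* m

        0≤t^1+m : 0# ≤ t ^ suc m
        0≤t^1+m = <⇒≤ (^-pos 0<t (suc m))

        regroup : ∀ q u v x y → q * (u * v) * (x * y) ≈ₖ u * (x * (q * v * y))
        regroup = solve 5 (λ q u v x y →
          q :* (u :* v) :* (x :* y) := u :* (x :* (q :* v :* y))) refl

-- Differences in the field, and the final bound

module _ {c₁ ℓ₁ ℓ₂} (K : OrderedField c₁ ℓ₁ ℓ₂) where
  open OrderedField K
  open OrderedFieldProperties K

  x-y+1≈fromℕ : ∀ {x y} k → x + 1# ≈ₖ fromℕ k + y → x - y + 1# ≈ₖ fromℕ k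
  x-y+1≈fromℕ {x} {y} k x+1≈k+y = begin
    x - y + 1#       ≈⟨ +-assoc x (- y) 1# ⟩
    x + (- y + 1#)   ≈⟨ +-congˡ (+-comm (- y) 1#) ⟩
    x + (1# - y)     ≈⟨ +-assoc x 1# (- y) ⟨
    x + 1# - y       ≈⟨ +-congʳ x+1≈k+y ⟩
    fromℕ k + y - y  ≈⟨ [x+y]-y≈x (fromℕ k) y ⟩
    fromℕ k          ∎
    where open ≈-Reasoning

  -- The + 1 cancels the shift between the one-based `index` and the zero-based `toℕ`.
  n-index+1≈ : ∀ {n} (i : Fin n) → fromℕ n - fromℕ (index i) + 1# ≈ₖ fromℕ (n ℕ.∸ toℕ i)
  n-index+1≈ {n} i = x-y+1≈fromℕ (n ℕ.∸ toℕ i) (begin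
    fromℕ n + 1#                           ≈⟨ +-comm (fromℕ n) 1# ⟩
    fromℕ (suc n)                          ≈⟨ fromℕ-cong eq ⟨
    fromℕ (n ℕ.∸ toℕ i ℕ.+ index i)        ≈⟨ fromℕ-homo-+ (n ℕ.∸ toℕ i) (index i) ⟩
    fromℕ (n ℕ.∸ toℕ i) + fromℕ (index i)  ∎)
    where
    open ≈-Reasoning
    eq : n ℕ.∸ toℕ i ℕ.+ index i ≡ suc n
    eq = ≡.trans (ℕ.+-suc (n ℕ.∸ toℕ i) (toℕ i)) (≡.cong suc (ℕ.m∸n+n≡m (Fin.toℕ≤n i)))

  x-m+1≈ : ∀ {x m N} → m ℕ.≤ N → x ≈ₖ fromℕ N → x - fromℕ m + 1# ≈ₖ fromℕ (suc (N ℕ.∸ m))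
  x-m+1≈ {x} {m} {N} m≤N x≈N = x-y+1≈fromℕ (suc (N ℕ.∸ m)) (begin
    x + 1#                           ≈⟨ trans (+-congʳ x≈N) (+-comm (fromℕ N) 1#) ⟩
    fromℕ (suc N)                    ≈⟨ fromℕ-cong (≡.cong suc (ℕ.m∸n+n≡m m≤N)) ⟨
    fromℕ (suc (N ℕ.∸ m) ℕ.+ m)      ≈⟨ fromℕ-homo-+ (suc (N ℕ.∸ m)) m ⟩
    fromℕ (suc (N ℕ.∸ m)) + fromℕ m  ∎)
    where open ≈-Reasoning

order*m*eff≡E : ∀ {n p} (σ : Table n) (G : Subgroup n p) (r : Fin n) (m : ℕ) .{{_ : NonZero m}} →
  fromℕℚ (Subgroup.order G ℕ.* m) ℚ.* eff-mst σ G r m ≡ E-mst σ r m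
order*m*eff≡E σ G r m = begin
  N ℚ.* (E-mst σ r m ℚ.* w)
    ≡⟨ ≡.cong (N ℚ.*_) (ℚ.*-comm (E-mst σ r m) w) ⟩
  N ℚ.* (w ℚ.* E-mst σ r m)
    ≡⟨ ℚ.*-assoc N w (E-mst σ r m) ⟨
  N ℚ.* w ℚ.* E-mst σ r m
    ≡⟨ ≡.cong (ℚ._* E-mst σ r m) (fromℕℚ-inverse (Subgroup.order G ℕ.* m) {{km-nonZero}}) ⟩
  1ℚ ℚ.* E-mst σ r m
    ≡⟨ ℚ.*-identityˡ (E-mst σ r m) ⟩
  E-mst σ r m ∎
  where
  open ≡.≡-Reasoning
  km-nonZero : NonZero (Subgroup.order G ℕ.* m)
  km-nonZero = ℕ.m*n≢0 (Subgroup.order G) m {{Subgroup.order-nonZero G}}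
  N = fromℕℚ (Subgroup.order G ℕ.* m)
  w = (+ 1 / (Subgroup.order G ℕ.* m)) {{km-nonZero}}

corollary6 : ∀ {c₁ ℓ₁ ℓ₂ p} (K : OrderedField c₁ ℓ₁ ℓ₂) (let open OrderedField K)
    (n m : ℕ) .{{_ : NonZero m}} → m ℕ.< n →
    (G : Subgroup n p) (let k = Subgroup.order G)
    (σ : Table n) → IsSwitchTable G σ →
    (r : Fin n) → IsMaxEffectiveRow σ r →
    (μ : 𝕂) → 0# < μ → μ < 1# →
    fromℕ m ≤ μ * (fromℕ n - fromℕ (index r) + 1#) →
    (∀ i → i Fin.≤ r →
    fromℕ (c σ i) + 1# ≤ μ * (fromℕ n - fromℕ (index i) + 1# - fromℕ m + 1#)) →
    let bound = fromℚ (+ 3 / 2) * (1# - μ) ^ (index r ℕ.* (m ℕ.+ 1)) in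
    bound ≤ fromℚ (eff-mst σ G r m) ×
    bound * fromℕ (k ℕ.* m) ≤ fromℚ (E-mst σ r m)
corollary6 K n m _ G σ isSwitchTable r (r-effective , maximal) μ 0<μ μ<1 m≤μN 1+c≤ =
  -- The bound on the relative effort is the bound on the expected cost with km cancelled.
  *-cancelʳ-≤-pos 0<km (≤-trans E≥ E≤) , E≥
  where
  open OrderedField K
  open OrderedFieldProperties K
  open SemiringExp (OrderedField.semiring K) using (^-congʳ)
  open IsStrictPartialOrder isStrictPartialOrder using (<-respʳ-≈)
  open ≤-Reasoning

  k = Subgroup.order G
  q = fromℚ (+ 3 / 2)
  t = 1# - μ
  is = take (toℕ r) (allFin n)

  0<t : 0# < t
  0<t = x<y⇒0<y-x μ<1

  km≢0 : NonZero (k ℕ.* m)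
  km≢0 = ℕ.m*n≢0 k m {{Subgroup.order-nonZero G}}

  0<km : 0# < fromℕ (k ℕ.* m)
  0<km = fromℕ-pos (ℕ.>-nonZero⁻¹ (k ℕ.* m) {{km≢0}})

  N≤ : ∀ {i} → i Fin.≤ r → n ℕ.∸ toℕ r ℕ.≤ n ℕ.∸ toℕ i
  N≤ = ℕ.∸-monoʳ-≤ n

  m≤μNᵣ : fromℕ m ≤ μ * fromℕ (n ℕ.∸ toℕ r)
  m≤μNᵣ = ≤-trans m≤μN (≤-reflexive (*-congˡ (n-index+1≈ K r)))

  -- Strict because μ < 1 and at least one point lies at or above r. This keeps the test for a full
  -- set from succeeding and makes the sample space nonempty.
  m<Nᵣ : m ℕ.< n ℕ.∸ toℕ r
  m<Nᵣ = fromℕ-cancel-< (≤-<-trans m≤μNᵣ (<-respʳ-≈ (*-identityˡ _)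
    (*-monoˡ-<-pos (fromℕ-pos (ℕ.m<n⇒0<n∸m (Fin.toℕ<n r))) μ<1)))

  sparse : ∀ i → i Fin.≤ r → Estimate.Sparse K ([x-y]+y≈x 1# μ) 0<t 0<μ σ m (ℕ.≢-nonZero⁻¹ m) i
  sparse i i≤r = record
    { m<n∸i = m<N
    -- Earlier rows have at least as many points, so the bound at row r carries over.
    ; m≤    = ≤-trans m≤μNᵣ (*-monoʳ-≤-nonNeg (<⇒≤ 0<μ) (fromℕ-mono-≤ (N≤ i≤r)))
    ; 1+c≤  = begin
        fromℕ (suc (c σ i))  ≈⟨ +-comm 1# (fromℕ (c σ i)) ⟩
        fromℕ (c σ i) + 1#   ≲⟨ 1+c≤ i i≤r ⟩
        μ * (fromℕ n - fromℕ (index i) + 1# - fromℕ m + 1#)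
                                      ≈⟨ *-congˡ (x-m+1≈ K (ℕ.<⇒≤ m<N) (n-index+1≈ K i)) ⟩
        μ * fromℕ (suc (n ℕ.∸ toℕ i ℕ.∸ m)) ∎
    }
    where
    m<N : m ℕ.< n ℕ.∸ toℕ i
    m<N = ℕ.<-≤-trans m<Nᵣ (N≤ i≤r)

  length-is : length is ≡ toℕ r
  length-is = ≡.trans (List.length-take (toℕ r) (allFin n))
    (ℕ.m≤n⇒m⊓n≡m (≡.subst (toℕ r ℕ.≤_) (≡.sym (List.length-tabulate {n = n} id)) (Fin.toℕ≤n r)))

  k≤ : k ℕ.* m ℕ.≤ product (map (suc ∘ c σ) is) ℕ.* (suc (c σ r) ℕ.* m)
  k≤ = ≡.subst (k ℕ.* m ℕ.≤_) (ℕ.*-assoc (product (map (suc ∘ c σ) is)) (suc (c σ r)) m)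
    (ℕ.*-monoˡ-≤ m (≡.subst (k ℕ.≤_) (rowProduct-suc G isSwitchTable r)
      (order≤ G isSwitchTable λ i r<i effective → ℕ.<⇒≱ r<i (maximal i effective))))

  0≤factor : 0# ≤ q * t ^ (index r ℕ.* (m ℕ.+ 1))
  0≤factor = ≤-trans (≤-reflexive (sym (zeroˡ _)))
    (*-monoˡ-≤-nonNeg (<⇒≤ (^-pos 0<t (index r ℕ.* (m ℕ.+ 1))))
      (fromℚ-nonNeg (+ 3 / 2) (ℚ.nonNegative⁻¹ (+ 3 / 2))))

  E≥ : q * t ^ (index r ℕ.* (m ℕ.+ 1)) * fromℕ (k ℕ.* m) ≤ fromℚ (E-mst σ r m)
  E≥ = begin
    q * t ^ (index r ℕ.* (m ℕ.+ 1)) * fromℕ (k ℕ.* m)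
      ≲⟨ *-monoʳ-≤-nonNeg 0≤factor (fromℕ-mono-≤ k≤) ⟩
    q * t ^ (index r ℕ.* (m ℕ.+ 1)) * fromℕ (product (map (suc ∘ c σ) is) ℕ.* (suc (c σ r) ℕ.* m))
      ≈⟨ *-congʳ (*-congˡ (^-congʳ t (≡.cong₂ ℕ._*_ (≡.cong suc (≡.sym length-is)) (ℕ.+-comm m 1)))) ⟩
    q * t ^ (suc (length is) ℕ.* suc m) * fromℕ (product (map (suc ∘ c σ) is) ℕ.* (suc (c σ r) ℕ.* m))
      ≲⟨ Estimate.E-from≥ K ([x-y]+y≈x 1# μ) 0<t 0<μ σ m (ℕ.≢-nonZero⁻¹ m)
           r-effective (sparse r ℕ.≤-refl) is
           (take-tabulate⁺ id (toℕ r) (λ i i<r → sparse i (ℕ.<⇒≤ i<r))) ⟩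
    fromℚ (E-from σ r is m)
      ≈⟨ reflexive (≡.cong (λ E → fromℚ (E m)) (E-mst≡E-from σ r)) ⟨
    fromℚ (E-mst σ r m) ∎

  0≤E : 0ℚ ℚ.≤ E-mst σ r m
  0≤E = ≡.subst (λ E → 0ℚ ℚ.≤ E m) (≡.sym (E-mst≡E-from σ r)) (E-from-nonNeg σ r is m)

  0≤eff : 0ℚ ℚ.≤ eff-mst σ G r m
  0≤eff = *-nonNeg 0≤E (ℚ.nonNegative⁻¹ _ {{ℚ.normalize-nonNeg 1 (k ℕ.* m) {{km≢0}}}})

  E≤ : fromℚ (E-mst σ r m) ≤ fromℚ (eff-mst σ G r m) * fromℕ (k ℕ.* m)
  E≤ = begin
    fromℚ (E-mst σ r m)
      ≈⟨ trans (*-congʳ fromℕ-1) (*-identityˡ _) ⟨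
    fromℕ 1 * fromℚ (E-mst σ r m)
      -- The rational identity km · eff = E crosses into the field as the inequality that the
      -- cancellation uses.
      ≲⟨ fromℚ-mono 1 (k ℕ.* m) (E-mst σ r m) (eff-mst σ G r m) 0≤E 0≤eff
           (ℚ.≤-reflexive (≡.trans (ℚ.*-identityˡ (E-mst σ r m)) (≡.sym (order*m*eff≡E σ G r m)))) ⟩
    fromℕ (k ℕ.* m) * fromℚ (eff-mst σ G r m)
      ≈⟨ *-comm _ _ ⟩
    fromℚ (eff-mst σ G r m) * fromℕ (k ℕ.* m) ∎
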